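{- Let $t\ge 2$ and $n\ge 1$ be integers, let $\omega$ be a primitive $t$-th root of unity and let $X=(x_1,\dots,x_n)$ be indeterminates. Let $\lambda$ be a partition with $\ell(\lambda)\le tn+1$, and write $n_i=n_i(\lambda,tn+1)$ and $\lambda^{(i)}$ ($0\le i\le t-1$) for the beta-set data and the $t$-quotient computed with $m=tn+1$ (see context). Consider the Schur polynomial $s_\lambda$ in the $tn+1$ variables $(X,\omega X,\dots,\omega^{t-1}X,1)=(x_1,\dots,x_n,\omega x_1,\dots,\omega x_n,\dots,\omega^{t-1}x_1,\dots,\omega^{t-1}x_n,1)$. (1) If the $t$-core of $\lambda$ has length greater than $1$, then $s_\lambda(X,\omega X,\dots,\omega^{t-1}X,1)=0$. (2) If the $t$-core of $\lambda$ equals the one-row partition $(c)$ for some $0\le c\le t-1$ (with $(0)$ the empty partition), then \[ s_\lambda(X,\omega X,\dots,\omega^{t-1}X,1)=(-1)^{\frac{t(t-1)}{2}\frac{n(n+1)}{2}-cn}\,\operatorname{sgn}(\sigma^c_\lambda)\, s_{\lambda^{(c)}}(x_1^t,\dots,x_n^t,1)\prod_{i\ne c,\,0\le i\le t-1} s_{\lambda^{(i)}}(x_1^t,\dots,x_n^t). \]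
   Context: For a sequence $\mu=(\mu_1,\dots,\mu_N)$ of nonnegative integers with $\mu_1\ge\dots\ge\mu_N$, the Schur polynomial in $N$ variables is $s_\mu(y_1,\dots,y_N)=\det(y_i^{\mu_j+N-j})_{i,j=1}^N/\det(y_i^{N-j})_{i,j=1}^N$ (for a partition with fewer than $N$ nonzero parts, pad with zeros). For a partition $\lambda$ with $\ell(\lambda)\le m$, its beta set is $\beta(\lambda,m)=(\beta_1,\dots,\beta_m)$ with $\beta_j=\lambda_j+m-j$. For $0\le i\le t-1$, $n_i(\lambda,m)$ is the number of entries of $\beta(\lambda,m)$ congruent to $i$ modulo $t$. The entries congruent to $i$ are written in decreasing order as $t\tilde\beta^{(i)}_1+i>\dots>t\tilde\beta^{(i)}_{n_i}+i$, and $\lambda^{(i)}$ is the partition with $n_i(\lambda,m)$ parts (some possibly zero) given by $\lambda^{(i)}_j=\tilde\beta^{(i)}_j-n_i(\lambda,m)+j$; the $t$-quotient is $(\lambda^{(0)},\dots,\lambda^{(t-1)})$. The $t$-core of $\lambda$ is the partition obtained by successively removing border strips (connected skew shapes containing no $2\times2$ square) of size $t$ from the Young diagram of $\lambda$ until no more can be removed; it is independent of choices. The permutation $\sigma^c_\lambda\in S_{tn+1}$ is defined by requiring that $(\beta_{\sigma^c_\lambda(1)},\dots,\beta_{\sigma^c_\lambda(tn+1)})$ (with $\beta=\beta(\lambda,tn+1)$) lists first the $n_c$ entries congruent to $c$ mod $t$ in decreasing order, then the entries congruent to $0$ in decreasing order, then those congruent to $1$, and so on up to $t-1$, skipping the residue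 $c$. -}

module Defs where

open import Level using (Level; _⊔_) renaming (suc to lsuc)
open import Algebra.Bundles using (CommutativeRing)
open import Data.Bool using (Bool; true; false; if_then_else_; not)
open import Data.Nat using (ℕ; zero; suc; _+_; _*_; _∸_; _≤_; _<_; _≡ᵇ_; _<ᵇ_; NonZero)
open import Data.Nat.DivMod using (_%_; _/_)
open import Data.List using (List; []; _∷_; _++_; length; map; zipWith; upTo; downFrom; take; replicate; concatMap; foldr)
open import Data.Fin using (Fin)
open import Data.Nat.ListAction using (sum)
open import Data.List using () renaming (allFin to allFinL)
open import Data.Product using (_×_)
open import Relation.Binary.PropositionalEquality using (_≡_)
open import Relation.Nullary using (¬_)

-- Fields (not in agda-stdlib): a commutative ring with 0 ≠ 1 in which
-- every nonzero element has an inverse.  The inverse is a total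
-- function whose value at 0 is unspecified (never used).

record Field (c ℓ : Level) : Set (lsuc (c ⊔ ℓ)) where
  field
    commutativeRing : CommutativeRing c ℓ
  open CommutativeRing commutativeRing public
    hiding (_*_)
  open CommutativeRing commutativeRing public
    using () renaming (_*_ to _·_)
  field
    _⁻¹        : Carrier → Carrier
    0≉1        : ¬ (0# ≈ 1#)
    ⁻¹-inverse : ∀ x → ¬ (x ≈ 0#) → (x · (x ⁻¹)) ≈ 1#

keep : ∀ {a} {A : Set a} → (A → Bool) → List A → List A
keep p [] = []
keep p (x ∷ xs) = if p x then x ∷ keep p xs else keep p xs

-- entry i of a list of naturals, 0 beyond the end (partitions padded by 0)
at : List ℕ → ℕ → ℕ
at [] i = 0
at (x ∷ xs) zero = x
at (x ∷ xs) (suc i) = at xs i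

dropAt : ∀ {a} {A : Set a} → ℕ → List A → List A
dropAt i [] = []
dropAt zero (x ∷ xs) = xs
dropAt (suc i) (x ∷ xs) = x ∷ dropAt i xs

pad : ℕ → List ℕ → List ℕ
pad N μ = take N (μ ++ replicate N 0)

-- Partitions (as weakly decreasing lists, possibly with trailing zeros)

Decreasing : List ℕ → Set
Decreasing [] = Data.Unit.⊤
  where import Data.Unit
Decreasing (a ∷ []) = Data.Unit.⊤
  where import Data.Unit
Decreasing (a ∷ b ∷ l) = b ≤ a × Decreasing (b ∷ l)

partLength : List ℕ → ℕ
partLength l = length (keep (λ a → 0 <ᵇ a) l)

-- μ is obtained from λ (same padded length) by removing a border strip of
-- size t: λ/μ is a skew shape of size t which contains no 2×2 square and
-- is connected.  Row i of λ/μ consists of the columns at μ i < j ≤ at λ i.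
RemovesStrip : ℕ → List ℕ → List ℕ → Set
RemovesStrip t lam mu =
    length mu ≡ length lam
  × Decreasing mu
  × (∀ i → at mu i ≤ at lam i)
  × sum lam ≡ sum mu + t
  -- no 2×2 square: rows i, i+1 share at most one column
  × (∀ i → at lam (suc i) ≤ suc (at mu i))
  -- connected: the nonempty rows form an interval ...
  × (∀ i j k → i ≤ j → j ≤ k → at mu i < at lam i → at mu k < at lam k
       → at mu j < at lam j)
  -- ... and consecutive nonempty rows share an edge
  × (∀ i → at mu i < at lam i → at mu (suc i) < at lam (suc i)
       → at mu i < at lam (suc i))

data Reach (t : ℕ) : List ℕ → List ℕ → Set where
  done : ∀ {lam} → Reach t lam lam
  step : ∀ {lam mu nu} → RemovesStrip t lam mu → Reach t mu nu → Reach t lam nu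

IsCore : ℕ → List ℕ → List ℕ → Set
IsCore t lam kappa = Reach t lam kappa × (∀ mu → ¬ RemovesStrip t kappa mu)

-- β(λ, m) with m = length of the (padded) list: β_j = λ_j + m - j
beta : List ℕ → List ℕ
beta lam = zipWith _+_ lam (downFrom (length lam))

betaRes : (t : ℕ) → .{{NonZero t}} → ℕ → List ℕ → List ℕ
betaRes t i lam = keep (λ b → (b % t) ≡ᵇ i) (beta lam)

nRes : (t : ℕ) → .{{NonZero t}} → ℕ → List ℕ → ℕ
nRes t i lam = length (betaRes t i lam)

-- λ^{(i)}: λ^{(i)}_j = β̃_j - n_i + j   (j 1-based; here j 0-based gives +1)
quotient : (t : ℕ) → .{{NonZero t}} → ℕ → List ℕ → List ℕ
quotient t i lam =
  zipWith (λ bt j → (bt + suc j) ∸ nRes t i lam)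
          (map (λ b → b / t) (betaRes t i lam))
          (upTo (nRes t i lam))

posRes : (t : ℕ) → .{{NonZero t}} → ℕ → List ℕ → List ℕ
posRes t i lam =
  keep (λ j → (at (beta lam) j % t) ≡ᵇ i) (upTo (length lam))

-- the one-line notation (σ(1), …, σ(m)) of σ^c_λ (0-based values)
sigmaList : (t : ℕ) → .{{NonZero t}} → ℕ → List ℕ → List ℕ
sigmaList t c lam =
  posRes t c lam ++
  concatMap (λ i → posRes t i lam) (keep (λ i → not (i ≡ᵇ c)) (upTo t))

inversions : List ℕ → ℕ
inversions [] = 0
inversions (a ∷ l) = length (keep (λ b → b <ᵇ a) l) + inversions l

module FieldOps {c ℓ} (F : Field c ℓ) where
  open Field F public renaming (_+_ to _⊕_)

  _^_ : Carrier → ℕ → Carrier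
  x ^ zero = 1#
  x ^ suc k = x · (x ^ k)

  sgnPow : ℕ → Carrier
  sgnPow k = (- 1#) ^ k

  sgn : List ℕ → Carrier
  sgn σ = sgnPow (inversions σ)

  mutual
    detN : ℕ → List (List Carrier) → Carrier
    detN zero _ = 1#
    detN (suc k) [] = 1#
    detN (suc k) (r ∷ rs) = expand k 0 r rs

    expand : ℕ → ℕ → List Carrier → List (List Carrier) → Carrier
    expand k j [] rs = 0#
    expand k j (a ∷ r) rs =
      ((sgnPow j · a) · detN k (map (dropAt j) rs)) ⊕ expand k (suc j) r rs

  det : List (List Carrier) → Carrier
  det M = detN (length M) M

  alternant : List Carrier → List ℕ → Carrier
  alternant ys μ =
    det (map (λ y → map (λ e → y ^ e)
                        (zipWith _+_ (pad (length ys) μ) (downFrom (length ys))))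
             ys)

  schur : List Carrier → List ℕ → Carrier
  schur ys μ = alternant ys μ · (alternant ys [] ⁻¹)

  prod : List Carrier → Carrier
  prod = foldr _·_ 1#

  Primitive : ℕ → Carrier → Set ℓ
  Primitive t ω = (ω ^ t ≈ 1#) × (∀ k → 1 ≤ k → k < t → ¬ (ω ^ k ≈ 1#))

  spec : (t n : ℕ) → Carrier → (Fin n → Carrier) → List Carrier
  spec t n ω x = concatMap (λ a → map (λ b → (ω ^ a) · x b) (allFinL n)) (upTo t) ++ (1# ∷ [])

  powVars : (t n : ℕ) → (Fin n → Carrier) → List Carrier
  powVars t n x = map (λ b → x b ^ t) (allFinL n)

{-# OPTIONS --safe #-}
module Submission where

open import Defs
open import Algebra.Bundles using (CommutativeMonoid; CommutativeRing)
open import Level using (Level; _⊔_)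
open import Data.Nat as ℕ using (ℕ; zero; suc; _+_; _*_; _∸_; _/_; _%_; _≤_; _<_; _≡ᵇ_; NonZero; z≤n; s≤s)
import Data.Nat.Properties as ℕ
import Data.Nat.DivMod as ℕ
open import Data.Nat.Divisibility using (m∣m*n)
open import Data.Nat.ListAction using (sum)
open import Data.Nat.ListAction.Properties using (sum-↭)
open import Data.Nat.Tactic.RingSolver using (solve-∀)
open import Data.List using (List; []; _∷_; _++_; map; filter; foldr; length; take; reverse; replicate; zipWith;
  concatMap; cartesianProduct; applyUpTo; applyDownFrom; upTo; downFrom; allFin)
import Data.List.Properties as List
open import Data.List.Relation.Unary.All as All using (All; []; _∷_)
import Data.List.Relation.Unary.All.Properties as All
open import Data.List.Relation.Unary.Any using (here; there)
open import Data.List.Relation.Unary.AllPairs as AllPairs using (AllPairs; []; _∷_)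
import Data.List.Relation.Unary.AllPairs.Properties as AllPairs
open import Data.List.Relation.Unary.Unique.Propositional using (Unique)
import Data.List.Relation.Unary.Unique.Propositional.Properties as Unique
open import Data.List.Membership.Propositional using (_∈_; _∉_)
open import Data.List.Membership.Propositional.Properties using (∈-∃++; ∈-map⁺; ∈-map⁻; ∈-filter⁺; ∈-filter⁻;
  ∈-upTo⁺; ∈-upTo⁻; ∈-downFrom⁺; ∈-downFrom⁻; ∈-allFin; ∈-cartesianProduct⁺; ∈-cartesianProduct⁻)
import Data.List.Membership.DecPropositional as DecMembership
open import Data.List.Relation.Binary.Permutation.Propositional
  using (_↭_; prep; swap; ↭-refl; ↭-reflexive; ↭-sym; ↭-trans; ↭⇒↭ₛ; ↭⇒↭ₛ′)
import Data.List.Relation.Binary.Permutation.Propositional.Properties as Perm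
import Data.List.Relation.Binary.Permutation.Setoid.Properties as PermSetoid
open import Data.List.Relation.Binary.Pointwise as Pointwise using (Pointwise; []; _∷_)
open import Data.Fin using (Fin)
import Data.Fin as Fin
open import Data.Bool using (true; false; not; if_then_else_)
open import Data.Product using (_×_; ∃; ∃₂; _,_; proj₁; proj₂)
open import Data.Unit using (tt)
open import Function using (_∘_; id)
open import Relation.Binary.PropositionalEquality as ≡ using (_≡_; _≢_; cong; cong₂; subst; subst₂)
open import Relation.Binary.Definitions using (DecidableEquality; tri<; tri≈; tri>)
open import Relation.Nullary.Decidable using (dec-true; dec-false)
open import Relation.Nullary using (¬_; yes; no; does; ¬?; contradiction)
open import Relation.Unary using (Pred; Decidable)

-- Let a row be a function of the column exponent e ∈ β(λ).  The row of the
-- variable ω^a x_b is e ↦ ω^(ae) x_b^e = Σ_i ω^(ai) [e ≡ i mod t] x_b^e, so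
-- the alternant of λ in (X, ωX, …, ω^(t-1)X, 1) is a constant, independent of
-- λ, times the determinant whose rows are e ↦ [e ≡ i mod t] x_b^e and e ↦ 1.
-- Since the constant also occurs in the Vandermonde determinant in the
-- denominator, it cancels.
--
-- The columns with residue i see only the n rows of that residue and the row
-- of ones.  Removing a border strip of size t lowers one beta number by t, so
-- the number n_i of columns with residue i depends only on the core, and the
-- beta numbers of a core are flush on each residue.  If the core has two
-- nonzero rows, two of its beta numbers are ≥ tn, so that either some
-- n_i ≥ n + 2 or two of the n_i are ≥ n + 1; both make the determinant vanish.
-- If the core is (c), sorting the columns by σ^c_λ makes the matrix block
-- triangular, the diagonal blocks being alternants in x_1^t, …, x_n^t (and 1)
-- of the quotients; the case λ = ∅, c = 0 evaluates the denominator.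

module ListProperties where
  open ≡ using (refl; sym; trans)

  private variable
    a b c p r : Level
    A : Set a
    B : Set b
    C : Set c
    P : Pred A p

  keep≡filter : (P? : Decidable P) → ∀ l → keep (does ∘ P?) l ≡ filter P? l
  keep≡filter P? [] = refl
  keep≡filter P? (x ∷ l) with does (P? x)
  ... | true  = cong (x ∷_) (keep≡filter P? l)
  ... | false = keep≡filter P? l

  filter-map : (P? : Decidable P) (f : A → B) → ∀ l → filter P? (map f l) ≡ map f (filter (P? ∘ f) l)
  filter-map P? f [] = refl
  filter-map P? f (x ∷ l) with does (P? (f x))
  ... | true  = cong (f x ∷_) (filter-map P? f l)
  ... | false = filter-map P? f l

  filter-singleton : (P? : Decidable P) → ∀ {x l} → Unique l → x ∈ l → P x → (∀ {y} → y ∈ l → P y → y ≡ x) →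
    filter P? l ≡ x ∷ []
  filter-singleton P? (x∉l ∷ _) (here refl) px unique = trans (List.filter-accept P? px)
    (cong (_ ∷_) (List.filter-none P? (All.tabulate λ y∈l py →
      All.lookup x∉l y∈l (sym (unique (there y∈l) py)))))
  filter-singleton P? (y∉l ∷ ul) (there x∈l) px unique = trans
    (List.filter-reject P? λ py → All.lookup y∉l x∈l (unique (here refl) py))
    (filter-singleton P? ul x∈l px (unique ∘ there))

  concatMap-cong-local : {f g : A → List B} → ∀ {l} → All (λ i → f i ≡ g i) l → concatMap f l ≡ concatMap g l
  concatMap-cong-local [] = refl
  concatMap-cong-local (eq ∷ eqs) = cong₂ _++_ eq (concatMap-cong-local eqs)

  concatMap-[] : ∀ (l : List A) → concatMap {B = B} (λ _ → []) l ≡ []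
  concatMap-[] [] = refl
  concatMap-[] (_ ∷ l) = concatMap-[] l

  length-concatMap : {f : A → List B} → ∀ {k l} → All (λ i → length (f i) ≡ k) l →
    length (concatMap f l) ≡ length l * k
  length-concatMap [] = refl
  length-concatMap {f = f} (eq ∷ eqs) = trans (List.length-++ (f _)) (cong₂ _+_ eq (length-concatMap eqs))

  map-cartesianProduct : ∀ (f : A × B → C) l m →
    map f (cartesianProduct l m) ≡ concatMap (λ i → map (λ j → f (i , j)) m) l
  map-cartesianProduct f [] m = refl
  map-cartesianProduct f (i ∷ l) m = trans (List.map-++ f (map (i ,_) m) _)
    (cong₂ _++_ (sym (List.map-∘ m)) (map-cartesianProduct f l m))

  length-cartesianProduct : ∀ (l : List A) (m : List B) → length (cartesianProduct l m) ≡ length l * length m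
  length-cartesianProduct [] m = refl
  length-cartesianProduct (i ∷ l) m = trans (List.length-++ (map (i ,_) m))
    (cong₂ _+_ (List.length-map (i ,_) m) (length-cartesianProduct l m))

  Unique⇒AllPairs : {R : A → A → Set r} → ∀ {l} → Unique l →
    (∀ {i j} → i ∈ l → j ∈ l → i ≢ j → R i j) → AllPairs R l
  Unique⇒AllPairs [] _ = []
  Unique⇒AllPairs (i∉l ∷ ul) R-≢ =
    All.tabulate (λ j∈l → R-≢ (here refl) (there j∈l) (All.lookup i∉l j∈l)) ∷
    Unique⇒AllPairs ul (λ i∈ j∈ → R-≢ (there i∈) (there j∈))

  Unique-⊆⇒length≤ : ∀ {l m : List A} → Unique l → (∀ {x} → x ∈ l → x ∈ m) → length l ≤ length m
  Unique-⊆⇒length≤ [] _ = z≤n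
  Unique-⊆⇒length≤ {l = x ∷ l} (x∉l ∷ ul) ⊆m with p , q , refl ← ∈-∃++ (⊆m (here refl)) =
    ℕ.≤-trans (s≤s (Unique-⊆⇒length≤ ul ⊆p++q)) (ℕ.≤-reflexive (sym (Perm.↭-length (Perm.shift x p q))))
    where
    ⊆p++q : ∀ {y} → y ∈ l → y ∈ p ++ q
    ⊆p++q y∈l with Perm.∈-resp-↭ (Perm.shift x p q) (⊆m (there y∈l))
    ... | here refl = contradiction refl (All.lookup x∉l y∈l)
    ... | there y∈ = y∈

  applyUpTo-+ : ∀ (f : ℕ → A) m n → applyUpTo f (m + n) ≡ applyUpTo f m ++ applyUpTo (f ∘ (m +_)) n
  applyUpTo-+ f zero n = refl
  applyUpTo-+ f (suc m) n = cong (f 0 ∷_) (applyUpTo-+ (f ∘ suc) m n)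

  downFrom-+ : ∀ m n → downFrom (m + n) ≡ map (n +_) (downFrom m) ++ downFrom n
  downFrom-+ zero n = refl
  downFrom-+ (suc m) n = cong₂ _∷_ (ℕ.+-comm m n) (downFrom-+ m n)

  take-length-++ : ∀ (l m : List A) → take (length l) (l ++ m) ≡ l
  take-length-++ [] m = refl
  take-length-++ (x ∷ l) m = cong (x ∷_) (take-length-++ l m)

  runner : ℕ → ℕ → ℕ → List ℕ
  runner t i = applyDownFrom (λ q → t * q + i)

  triangle : ℕ → ℕ
  triangle k = sum (downFrom k)

  triangle-*2 : ∀ k → triangle k * 2 ≡ k * (k ∸ 1)
  triangle-*2 zero = refl
  triangle-*2 (suc zero) = refl
  triangle-*2 (suc (suc k)) = trans (ℕ.*-distribʳ-+ 2 (suc k) (triangle (suc k)))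
    (trans (cong (suc k * 2 +_) (triangle-*2 (suc k))) (rearrange k))
    where
    rearrange : ∀ k → suc k * 2 + suc k * k ≡ suc (suc k) * suc k
    rearrange = solve-∀

  triangle≡ : ∀ k → triangle k ≡ (k * (k ∸ 1)) / 2
  triangle≡ k = trans (sym (ℕ.m*n/n≡m (triangle k) 2)) (cong (_/ 2) (triangle-*2 k))

  map-at : ∀ l → map (at l) (upTo (length l)) ≡ l
  map-at l = trans (List.map-upTo (at l) (length l)) (applyUpTo-at l)
    where
    applyUpTo-at : ∀ l → applyUpTo (at l) (length l) ≡ l
    applyUpTo-at [] = refl
    applyUpTo-at (x ∷ l) = cong (x ∷_) (applyUpTo-at l)

  at-injective : ∀ k l → length l ≡ length k → (∀ i → at l i ≡ at k i) → l ≡ k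
  at-injective [] [] _ _ = refl
  at-injective (a ∷ k) (b ∷ l) len eq =
    cong₂ _∷_ (eq 0) (at-injective k l (ℕ.suc-injective len) (eq ∘ suc))

  module _ (_≟_ : DecidableEquality B) (f : A → B) where
    open DecMembership _≟_ using (_∈?_)

    private
      fibre : List A → B → List A
      fibre l i = filter (λ x → f x ≟ i) l

      fibres-∉ : ∀ x l {L} → All (f x ≢_) L → concatMap (fibre (x ∷ l)) L ≡ concatMap (fibre l) L
      fibres-∉ x l fx≢ = concatMap-cong-local (All.map (List.filter-reject (λ y → f y ≟ _)) fx≢)

      fibres-∈ : ∀ x l {L} → Unique L → f x ∈ L → concatMap (fibre (x ∷ l)) L ↭ x ∷ concatMap (fibre l) L
      fibres-∈ x l (fx∉L ∷ _) (here refl) =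
        ↭-reflexive (cong₂ _++_ (List.filter-accept (λ y → f y ≟ f x) refl) (fibres-∉ x l fx∉L))
      fibres-∈ x l {i ∷ L} (i∉L ∷ uL) (there fx∈L) =
        ↭-trans (↭-reflexive (cong (_++ _) (List.filter-reject (λ y → f y ≟ i) (All.lookup i∉L fx∈L ∘ sym))))
          (↭-trans (Perm.++⁺ˡ (fibre l i) (fibres-∈ x l uL fx∈L)) (Perm.shift x (fibre l i) _))

    concatMap-fibres : ∀ l {L} → Unique L →
      concatMap (λ i → filter (λ x → f x ≟ i) l) L ↭ filter (λ x → f x ∈? L) l
    concatMap-fibres [] {L} _ = ↭-reflexive (concatMap-[] L)
    concatMap-fibres (x ∷ l) {L} uL with f x ∈? L
    ... | yes fx∈L = ↭-trans (fibres-∈ x l uL fx∈L) (prep x (concatMap-fibres l uL))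
    ... | no fx∉L = ↭-trans (↭-reflexive (fibres-∉ x l (All.tabulate λ { i∈L refl → fx∉L i∈L })))
                      (concatMap-fibres l uL)

  count : {P : Pred A p} → Decidable P → List A → ℕ
  count P? l = length (filter P? l)

  inversions-∷ : ∀ x l → inversions (x ∷ l) ≡ count (ℕ._<? x) l + inversions l
  inversions-∷ x l = cong (λ m → length m + inversions l) (keep≡filter (ℕ._<? x) l)

  inversions-insert-min : ∀ p u q → All (u <_) (p ++ q) →
    inversions (p ++ u ∷ q) ≡ length p + inversions (p ++ q)
  inversions-insert-min [] u q u<q = trans (inversions-∷ u q)
    (cong (λ l → length l + inversions q) (List.filter-none (ℕ._<? u) (All.map ℕ.<⇒≯ u<q)))
  inversions-insert-min (x ∷ p) u q (u<x ∷ u<) = begin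
    inversions (x ∷ p ++ u ∷ q)
      ≡⟨ inversions-∷ x (p ++ u ∷ q) ⟩
    count (ℕ._<? x) (p ++ u ∷ q) + inversions (p ++ u ∷ q)
      ≡⟨ cong₂ _+_ count-insert (inversions-insert-min p u q u<) ⟩
    suc (count (ℕ._<? x) (p ++ q)) + (length p + inversions (p ++ q))
      ≡⟨ exchange (count (ℕ._<? x) (p ++ q)) (length p) (inversions (p ++ q)) ⟩
    suc (length p) + (count (ℕ._<? x) (p ++ q) + inversions (p ++ q))
      ≡⟨ cong (suc (length p) +_) (inversions-∷ x (p ++ q)) ⟨
    suc (length p) + inversions (x ∷ p ++ q) ∎
    where
    open ≡.≡-Reasoning
    count-insert : count (ℕ._<? x) (p ++ u ∷ q) ≡ suc (count (ℕ._<? x) (p ++ q))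
    count-insert = trans (Perm.↭-length (Perm.filter-↭ (ℕ._<? x) (Perm.shift u p q)))
      (cong length (List.filter-accept (ℕ._<? x) u<x))
    exchange : ∀ i j k → suc i + (j + k) ≡ suc j + (i + k)
    exchange = solve-∀

open ListProperties

module BigOperator {c ℓ} (M : CommutativeMonoid c ℓ) where
  open CommutativeMonoid M
  open import Algebra.Solver.CommutativeMonoid M using (solve; _⊜_; _⊕_)

  private variable
    a : Level
    A : Set a
    f g : A → Carrier

  fold : (A → Carrier) → List A → Carrier
  fold f l = foldr _∙_ ε (map f l)

  fold-map : ∀ {b} {B : Set b} (f : B → Carrier) (h : A → B) l → fold f (map h l) ≡ fold (f ∘ h) l
  fold-map f h l = cong (foldr _∙_ ε) (≡.sym (List.map-∘ l))

  fold-cong : ∀ {l} → All (λ i → f i ≈ g i) l → fold f l ≈ fold g l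
  fold-cong [] = refl
  fold-cong (eq ∷ eqs) = ∙-cong eq (fold-cong eqs)

  fold-ε : ∀ {l} → All (λ i → f i ≈ ε) l → fold f l ≈ ε
  fold-ε [] = refl
  fold-ε (eq ∷ eqs) = trans (∙-cong eq (fold-ε eqs)) (identityˡ ε)

  fold-∙ : ∀ l → fold (λ i → f i ∙ g i) l ≈ fold f l ∙ fold g l
  fold-∙ [] = sym (identityˡ ε)
  fold-∙ (i ∷ l) = trans (∙-congˡ (fold-∙ l))
    (solve 4 (λ u v p q → ((u ⊕ v) ⊕ (p ⊕ q)) ⊜ ((u ⊕ p) ⊕ (v ⊕ q))) refl _ _ _ _)

  fold-↭ : ∀ (f : A → Carrier) {l m} → l ↭ m → fold f l ≈ fold f m
  fold-↭ f l↭m = PermSetoid.foldr-commMonoid setoid isCommutativeMonoid (↭⇒↭ₛ′ isEquivalence (Perm.map⁺ f l↭m))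

  fold-++-single : ∀ (f : A → Carrier) l {i} → f i ≈ ε → fold f (l ++ i ∷ []) ≈ fold f l
  fold-++-single f l {i} fi≈ε = trans (fold-↭ f (↭-sym (Perm.∷↭∷ʳ i l))) (trans (∙-congʳ fi≈ε) (identityˡ _))

  fold-single : ∀ {l k} → Unique l → k ∈ l → (∀ i → i ≢ k → f i ≈ ε) → fold f l ≈ f k
  fold-single {f = f} {k = k} ul k∈l f≈ε with p , q , ≡.refl ← ∈-∃++ k∈l
    with k∉ ∷ _ ← PermSetoid.Unique-resp-↭ (≡.setoid _) (↭⇒↭ₛ (Perm.shift k p q)) ul
    = trans (fold-↭ f (Perm.shift k p q))
        (trans (∙-congˡ (fold-ε (All.map (λ k≢i → f≈ε _ (k≢i ∘ ≡.sym)) k∉))) (identityʳ _))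

module BetaSets where
  open ≡ using (refl; sym; trans)

  private variable
    a : ℕ
    as : List ℕ

  Decreasing-tail : Decreasing (a ∷ as) → Decreasing as
  Decreasing-tail {as = []} _ = tt
  Decreasing-tail {as = _ ∷ _} (_ , dec) = dec

  Decreasing-head : Decreasing (a ∷ as) → at as 0 ≤ a
  Decreasing-head {as = []} _ = z≤n
  Decreasing-head {as = _ ∷ _} (a₁≤a , _) = a₁≤a

  Decreasing-∷ : at as 0 ≤ a → Decreasing as → Decreasing (a ∷ as)
  Decreasing-∷ {as = []} _ _ = tt
  Decreasing-∷ {as = _ ∷ _} a₁≤a dec = a₁≤a , dec

  at-suc≤at : Decreasing as → ∀ i → at as (suc i) ≤ at as i
  at-suc≤at {as = []} _ i = z≤n
  at-suc≤at {as = a ∷ as} dec zero = Decreasing-head dec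
  at-suc≤at {as = a ∷ as} dec (suc i) = at-suc≤at (Decreasing-tail dec) i

  length-beta : ∀ lam → length (beta lam) ≡ length lam
  length-beta lam = trans (List.length-zipWith _+_ lam (downFrom (length lam)))
    (trans (cong (length lam ℕ.⊓_) (List.length-downFrom (length lam))) (ℕ.⊓-idem (length lam)))

  sum-beta : ∀ lam → sum (beta lam) ≡ sum lam + triangle (length lam)
  sum-beta [] = refl
  sum-beta (a ∷ as) = trans (cong (a + length as +_) (sum-beta as))
    (interchange a (length as) (sum as) (triangle (length as)))
    where
    interchange : ∀ a l s τ → (a + l) + (s + τ) ≡ (a + s) + (l + τ)
    interchange = solve-∀

  beta-strict : ∀ lam → Decreasing lam → AllPairs ℕ._>_ (beta lam)
  beta-strict [] _ = []
  beta-strict (a ∷ as) dec = all-below a as dec ∷ beta-strict as (Decreasing-tail dec)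
    where
    all-below : ∀ a as → Decreasing (a ∷ as) → All (_< a + length as) (beta as)
    all-below a [] _ = []
    all-below a (a₁ ∷ as) (a₁≤a , dec) = ℕ.+-mono-≤-< a₁≤a ℕ.≤-refl ∷
      All.map (λ b< → ℕ.<-≤-trans b< (ℕ.+-mono-≤ a₁≤a (ℕ.n≤1+n _))) (all-below a₁ as dec)

  beta-replicate-0 : ∀ m → beta (replicate m 0) ≡ downFrom m
  beta-replicate-0 zero = refl
  beta-replicate-0 (suc m) = cong₂ _∷_ (List.length-replicate m) (beta-replicate-0 m)

  partLength-zero : ∀ lam → Decreasing lam → at lam 0 ≤ 0 → partLength lam ≡ 0
  partLength-zero [] _ _ = refl
  partLength-zero (zero ∷ lam) dec _ = partLength-zero lam (Decreasing-tail dec) (Decreasing-head dec)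

  second-part-positive : ∀ lam → Decreasing lam → 1 < partLength lam → 0 < at lam 1
  second-part-positive (zero ∷ as) dec 1<len =
    contradiction (subst (1 <_) (partLength-zero as (Decreasing-tail dec) (Decreasing-head dec)) 1<len) λ ()
  second-part-positive (suc a ∷ as) dec (s≤s 0<len) with at as 0 ℕ.≟ 0
  ... | no a₁≢0 = ℕ.n≢0⇒n>0 a₁≢0
  ... | yes a₁≡0 = contradiction 0<len
        (ℕ.≤⇒≯ (ℕ.≤-reflexive (partLength-zero as (Decreasing-tail dec) (ℕ.≤-reflexive a₁≡0))))

  two-large-betas : ∀ {m} lam → length lam ≡ m + 1 → Decreasing lam → 1 < partLength lam →
    ∃₂ λ d e → d ∈ beta lam × e ∈ beta lam × m ≤ e × e < d
  two-large-betas (a ∷ []) _ dec 1<len with () ← second-part-positive (a ∷ []) dec 1<len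
  two-large-betas {m} (a ∷ b ∷ as) len dec 1<len =
    a + suc (length as) , b + length as , here refl , there (here refl) ,
    ℕ.≤-trans (ℕ.≤-reflexive (ℕ.suc-injective (trans (ℕ.+-comm 1 m) (sym len))))
      (ℕ.+-monoˡ-≤ (length as) (second-part-positive (a ∷ b ∷ as) dec 1<len)) ,
    ℕ.+-mono-≤-< (proj₁ dec) ℕ.≤-refl

  fromBeta : List ℕ → List ℕ
  fromBeta [] = []
  fromBeta (b ∷ B) = b ∸ length B ∷ fromBeta B

  length-fromBeta : ∀ B → length (fromBeta B) ≡ length B
  length-fromBeta [] = refl
  length-fromBeta (_ ∷ B) = cong suc (length-fromBeta B)

  -- Strictness makes the truncated subtraction in fromBeta, and so in the definition of the quotient, harmless.
  beta-fromBeta : ∀ {B} → AllPairs ℕ._>_ B → beta (fromBeta B) ≡ B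
  beta-fromBeta [] = refl
  beta-fromBeta {b ∷ B} B>@(_ ∷ B>′) = cong₂ _∷_
    (trans (cong (b ∸ length B +_) (length-fromBeta B)) (ℕ.m∸n+n≡m (length≤head B>))) (beta-fromBeta B>′)
    where
    length≤head : ∀ {b B} → AllPairs ℕ._>_ (b ∷ B) → length B ≤ b
    length≤head {B = []} _ = z≤n
    length≤head {B = _ ∷ _} ((b>b₁ ∷ _) ∷ B>) = ℕ.≤-trans (s≤s (length≤head B>)) b>b₁

  zipWith-fromBeta : ∀ o N {f : ℕ → ℕ} B → (∀ j → f j ≡ o + j) → o + length B ≡ N →
    zipWith (λ b j → (b + suc j) ∸ N) B (applyUpTo f (length B)) ≡ fromBeta B
  zipWith-fromBeta o N [] _ _ = refl
  zipWith-fromBeta o N {f} (b ∷ B) f≡ refl = cong₂ _∷_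
    (begin
      b + suc (f 0) ∸ (o + suc (length B))   ≡⟨ cong (λ j → b + suc j ∸ (o + suc (length B))) f0≡o ⟩
      b + suc o ∸ (o + suc (length B))       ≡⟨ cong₂ _∸_ (ℕ.+-comm b (suc o)) (ℕ.+-suc o (length B)) ⟩
      suc o + b ∸ (suc o + length B)         ≡⟨ ℕ.[m+n]∸[m+o]≡n∸o (suc o) b (length B) ⟩
      b ∸ length B                           ∎)
    (zipWith-fromBeta (suc o) N B (λ j → trans (f≡ (suc j)) (ℕ.+-suc o j)) (sym (ℕ.+-suc o (length B))))
    where
    open ≡.≡-Reasoning
    f0≡o : f 0 ≡ o
    f0≡o = trans (f≡ 0) (ℕ.+-identityʳ o)

  exponents : ℕ → List ℕ → List ℕ
  exponents N μ = zipWith _+_ (pad N μ) (downFrom N)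

  length-exponents : ∀ N μ → length (exponents N μ) ≡ N
  length-exponents N μ = begin
    length (exponents N μ)                       ≡⟨ List.length-zipWith _+_ (pad N μ) (downFrom N) ⟩
    length (pad N μ) ℕ.⊓ length (downFrom N)     ≡⟨ cong₂ ℕ._⊓_ length-pad (List.length-downFrom N) ⟩
    N ℕ.⊓ N                                      ≡⟨ ℕ.⊓-idem N ⟩
    N                                            ∎
    where
    open ≡.≡-Reasoning
    N≤ : N ≤ length (μ ++ replicate N 0)
    N≤ = subst (_≤ length (μ ++ replicate N 0)) (List.length-replicate N)
      (List.length-++-≤ʳ (replicate N 0) {μ})
    length-pad : length (pad N μ) ≡ N
    length-pad = trans (List.length-take N (μ ++ replicate N 0)) (ℕ.m≤n⇒m⊓n≡m N≤)

  exponents≡beta : ∀ {N μ} → length μ ≡ N → exponents N μ ≡ beta μ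
  exponents≡beta {μ = μ} refl = cong (λ ν → zipWith _+_ ν (downFrom (length μ)))
    (take-length-++ μ (replicate (length μ) 0))

  exponents-[] : ∀ N → exponents N [] ≡ downFrom N
  exponents-[] N = begin
    zipWith _+_ (pad N []) (downFrom N)
      ≡⟨ cong (λ ν → zipWith _+_ ν (downFrom N)) pad-[] ⟩
    zipWith _+_ (replicate N 0) (downFrom N)
      ≡⟨ cong (zipWith _+_ (replicate N 0) ∘ downFrom) (List.length-replicate N) ⟨
    beta (replicate N 0)
      ≡⟨ beta-replicate-0 N ⟩
    downFrom N ∎
    where
    open ≡.≡-Reasoning
    pad-[] : pad N [] ≡ replicate N 0
    pad-[] = List.take-all N (replicate N 0) (ℕ.≤-reflexive (List.length-replicate N))

open BetaSets

module BorderStrips where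
  open ≡ using (refl; sym; trans)

  private variable
    a b d t : ℕ
    as bs lam mu : List ℕ

  -- The conditions of RemovesStrip without the size of the strip, so that they pass to the lower rows.
  record BorderStrip (lam mu : List ℕ) : Set where
    field
      length≡    : length mu ≡ length lam
      decreasing : Decreasing mu
      below      : ∀ i → at mu i ≤ at lam i
      no-square  : ∀ i → at lam (suc i) ≤ suc (at mu i)
      interval   : ∀ i j k → i ≤ j → j ≤ k → at mu i < at lam i → at mu k < at lam k → at mu j < at lam j
      edge       : ∀ i → at mu i < at lam i → at mu (suc i) < at lam (suc i) → at mu i < at lam (suc i)

  open BorderStrip

  removesStrip⇒borderStrip : RemovesStrip t lam mu → BorderStrip lam mu
  removesStrip⇒borderStrip (length≡ , decreasing , below , _ , no-square , interval , edge) = record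
    { length≡ = length≡ ; decreasing = decreasing ; below = below
    ; no-square = no-square ; interval = interval ; edge = edge }

  borderStrip-tail : BorderStrip (a ∷ as) (b ∷ bs) → BorderStrip as bs
  borderStrip-tail strip = record
    { length≡ = ℕ.suc-injective (length≡ strip) ; decreasing = Decreasing-tail (decreasing strip)
    ; below = below strip ∘ suc ; no-square = no-square strip ∘ suc
    ; interval = λ i j k i≤j j≤k → interval strip (suc i) (suc j) (suc k) (s≤s i≤j) (s≤s j≤k)
    ; edge = edge strip ∘ suc }

  -- A border strip follows the rim of lam: in each of its rows but the last, mu i = lam (i + 1) - 1.
  data TopRimHook : List ℕ → List ℕ → Set where
    last : at as 0 ≤ b → b < a → TopRimHook (a ∷ as) (b ∷ as)
    next : b < a → TopRimHook (suc b ∷ as) mu → TopRimHook (a ∷ suc b ∷ as) (b ∷ mu)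

  data RimHook : List ℕ → List ℕ → Set where
    top  : TopRimHook lam mu → RimHook lam mu
    skip : RimHook lam mu → RimHook (a ∷ lam) (a ∷ mu)

  borderStrip⇒topRimHook : BorderStrip (a ∷ as) (b ∷ bs) → b < a → TopRimHook (a ∷ as) (b ∷ bs)
  borderStrip⇒topRimHook {as = []} {bs = []} _ b<a = last z≤n b<a
  borderStrip⇒topRimHook {as = []} {bs = _ ∷ _} strip _ with () ← length≡ strip
  borderStrip⇒topRimHook {as = _ ∷ _} {bs = []} strip _ with () ← length≡ strip
  borderStrip⇒topRimHook {as = a₁ ∷ as} {bs = b₁ ∷ bs} strip b<a with b₁ ℕ.<? a₁
  ... | yes b₁<a₁ with refl ← ℕ.≤-antisym (no-square strip 0) (edge strip 0 b<a b₁<a₁) =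
        next b<a (borderStrip⇒topRimHook (borderStrip-tail strip) b₁<a₁)
  ... | no b₁≮a₁ with refl ← at-injective (a₁ ∷ as) (b₁ ∷ bs) (ℕ.suc-injective (length≡ strip))
          (λ i → ℕ.≤∧≮⇒≡ (below strip (suc i)) (b₁≮a₁ ∘ interval strip 0 1 (suc i) z≤n (s≤s z≤n) b<a)) =
        last (Decreasing-head (decreasing strip)) b<a

  borderStrip⇒rimHook : BorderStrip lam mu → sum mu < sum lam → RimHook lam mu
  borderStrip⇒rimHook {[]} {[]} _ ()
  borderStrip⇒rimHook {[]} {_ ∷ _} strip _ with () ← length≡ strip
  borderStrip⇒rimHook {_ ∷ _} {[]} strip _ with () ← length≡ strip
  borderStrip⇒rimHook {a ∷ as} {b ∷ bs} strip sum< with b ℕ.<? a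
  ... | yes b<a = top (borderStrip⇒topRimHook strip b<a)
  ... | no b≮a with refl ← ℕ.≤∧≮⇒≡ (below strip 0) b≮a =
        skip (borderStrip⇒rimHook (borderStrip-tail strip) (ℕ.+-cancelˡ-< a _ _ sum<))

  topRimHook-length : TopRimHook lam mu → length mu ≡ length lam
  topRimHook-length (last _ _) = refl
  topRimHook-length (next _ hook) = cong suc (topRimHook-length hook)

  topRimHook-head : TopRimHook lam mu → at mu 0 < at lam 0
  topRimHook-head (last _ b<a) = b<a
  topRimHook-head (next b<a _) = b<a

  topRimHook-decreasing : Decreasing lam → TopRimHook lam mu → Decreasing mu
  topRimHook-decreasing dec (last a₁≤b _) = Decreasing-∷ a₁≤b (Decreasing-tail dec)
  topRimHook-decreasing (_ , dec) (next _ hook) =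
    Decreasing-∷ (ℕ.≤-pred (topRimHook-head hook)) (topRimHook-decreasing dec hook)

  topRimHook-below : TopRimHook lam mu → ∀ i → at mu i ≤ at lam i
  topRimHook-below hook zero = ℕ.<⇒≤ (topRimHook-head hook)
  topRimHook-below (last _ _) (suc i) = ℕ.≤-refl
  topRimHook-below (next _ hook) (suc i) = topRimHook-below hook i

  topRimHook-no-square : Decreasing lam → TopRimHook lam mu → ∀ i → at lam (suc i) ≤ suc (at mu i)
  topRimHook-no-square _ (last a₁≤b _) zero = ℕ.m≤n⇒m≤1+n a₁≤b
  topRimHook-no-square dec (last _ _) (suc i) = ℕ.m≤n⇒m≤1+n (at-suc≤at (Decreasing-tail dec) i)
  topRimHook-no-square _ (next _ _) zero = ℕ.≤-refl
  topRimHook-no-square (_ , dec) (next _ hook) (suc i) = topRimHook-no-square dec hook i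

  topRimHook-interval : TopRimHook lam mu → ∀ j k → j ≤ k → at mu k < at lam k → at mu j < at lam j
  topRimHook-interval hook zero _ _ _ = topRimHook-head hook
  topRimHook-interval (last _ _) (suc j) (suc k) _ lt = contradiction lt (ℕ.<-irrefl refl)
  topRimHook-interval (next _ hook) (suc j) (suc k) (s≤s j≤k) lt = topRimHook-interval hook j k j≤k lt

  topRimHook-edge : TopRimHook lam mu → ∀ i → at mu (suc i) < at lam (suc i) → at mu i < at lam (suc i)
  topRimHook-edge (last _ _) i lt = contradiction lt (ℕ.<-irrefl refl)
  topRimHook-edge (next _ _) zero _ = ℕ.≤-refl
  topRimHook-edge (next _ hook) (suc i) lt = topRimHook-edge hook i lt

  topRimHook⇒borderStrip : Decreasing lam → TopRimHook lam mu → BorderStrip lam mu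
  topRimHook⇒borderStrip dec hook = record
    { length≡ = topRimHook-length hook ; decreasing = topRimHook-decreasing dec hook
    ; below = topRimHook-below hook ; no-square = topRimHook-no-square dec hook
    ; interval = λ _ j k _ j≤k _ → topRimHook-interval hook j k j≤k
    ; edge = λ i _ → topRimHook-edge hook i }

  borderStrip-∷ : Decreasing (a ∷ lam) → BorderStrip lam mu → BorderStrip (a ∷ lam) (a ∷ mu)
  borderStrip-∷ dec strip = record
    { length≡ = cong suc (length≡ strip)
    ; decreasing = Decreasing-∷ (ℕ.≤-trans (below strip 0) (Decreasing-head dec)) (decreasing strip)
    ; below = λ { zero → ℕ.≤-refl ; (suc i) → below strip i }
    ; no-square = λ { zero → ℕ.m≤n⇒m≤1+n (Decreasing-head dec) ; (suc i) → no-square strip i }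
    ; interval = λ { zero _ _ _ _ lt → contradiction lt (ℕ.<-irrefl refl)
                   ; (suc i) (suc j) (suc k) (s≤s i≤j) (s≤s j≤k) → interval strip i j k i≤j j≤k }
    ; edge = λ { zero lt → contradiction lt (ℕ.<-irrefl refl) ; (suc i) → edge strip i } }

  rimHook⇒borderStrip : Decreasing lam → RimHook lam mu → BorderStrip lam mu
  rimHook⇒borderStrip dec (top hook) = topRimHook⇒borderStrip dec hook
  rimHook⇒borderStrip dec (skip hook) = borderStrip-∷ dec (rimHook⇒borderStrip (Decreasing-tail dec) hook)

  record Replaces (d b : ℕ) (ds bs : List ℕ) : Set where
    constructor replaces
    field
      {rest} : List ℕ
      old    : ds ↭ d ∷ rest
      new    : bs ↭ b ∷ rest

  replaces-∷ : length mu ≡ length lam → Replaces d b (beta lam) (beta mu) →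
    Replaces d b (beta (a ∷ lam)) (beta (a ∷ mu))
  replaces-∷ len (replaces old new) rewrite len =
    replaces (↭-trans (prep _ old) (swap _ _ ↭-refl)) (↭-trans (prep _ new) (swap _ _ ↭-refl))

  -- Where the strip continues into the next row, the new beta number b + length mu is the old one of that row.
  beta-next : length mu ≡ suc (length as) → beta mu ↭ d ∷ beta as → beta (b ∷ mu) ↭ d ∷ beta (suc b ∷ as)
  beta-next {mu} {as} {d} {b} len perm = ↭-trans (prep _ perm)
    (↭-trans (swap _ _ ↭-refl) (↭-reflexive (cong (λ e → d ∷ e ∷ beta as) next-row)))
    where
    next-row : b + length mu ≡ suc b + length as
    next-row = trans (cong (b +_) len) (ℕ.+-suc b (length as))

  topRimHook-beta : TopRimHook (a ∷ as) mu → ∃ λ d → beta mu ↭ d ∷ beta as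
  topRimHook-beta (last _ _) = _ , ↭-refl
  topRimHook-beta (next _ hook) with d , perm ← topRimHook-beta hook =
    d , beta-next (topRimHook-length hook) perm

  rimHook-length : RimHook lam mu → length mu ≡ length lam
  rimHook-length (top hook) = topRimHook-length hook
  rimHook-length (skip hook) = cong suc (rimHook-length hook)

  rimHook-beta : RimHook lam mu → ∃₂ λ d b → Replaces d b (beta lam) (beta mu)
  rimHook-beta {[]} (top ())
  rimHook-beta {_ ∷ _} (top hook) = _ , _ , replaces ↭-refl (proj₂ (topRimHook-beta hook))
  rimHook-beta (skip hook) with d , b , repl ← rimHook-beta hook = d , b , replaces-∷ (rimHook-length hook) repl

  replaces-sum : length mu ≡ length lam → Replaces d b (beta lam) (beta mu) → b + sum lam ≡ d + sum mu
  replaces-sum {mu} {lam} {d} {b} len (replaces {rest} old new) = ℕ.+-cancelʳ-≡ τ _ _ (begin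
    (b + sum lam) + τ                     ≡⟨ ℕ.+-assoc b (sum lam) τ ⟩
    b + (sum lam + τ)                     ≡⟨ cong (b +_) (trans (sym (sum-beta lam)) (sum-↭ old)) ⟩
    b + (d + sum rest)                    ≡⟨ exchange b d (sum rest) ⟩
    d + (b + sum rest)                    ≡⟨ cong (d +_) (trans (sym (sum-↭ new)) (sum-beta mu)) ⟩
    d + (sum mu + triangle (length mu))   ≡⟨ cong (λ l → d + (sum mu + triangle l)) len ⟩
    d + (sum mu + τ)                      ≡⟨ ℕ.+-assoc d (sum mu) τ ⟨
    (d + sum mu) + τ                      ∎)
    where
    open ≡.≡-Reasoning
    τ = triangle (length lam)
    exchange : ∀ b d r → b + (d + r) ≡ d + (b + r)
    exchange = solve-∀

  removesStrip-beta : ∀ lam mu → 1 ≤ t → RemovesStrip t lam mu → ∃ λ b → Replaces (b + t) b (beta lam) (beta mu)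
  removesStrip-beta {t} lam mu 1≤t removes@(len , _ , _ , sum≡ , _)
    with d , b , repl ← rimHook-beta (borderStrip⇒rimHook (removesStrip⇒borderStrip removes)
           (subst (sum mu <_) (sym sum≡) (ℕ.m<m+n (sum mu) 1≤t)))
    = b , subst (λ e → Replaces e b (beta lam) (beta mu)) d≡ repl
    where
    d≡ : d ≡ b + t
    d≡ = ℕ.+-cancelʳ-≡ (sum mu) _ _
      (trans (sym (replaces-sum len repl)) (trans (cong (b +_) sum≡) (rearrange b (sum mu) t)))
      where
      rearrange : ∀ b s t → b + (s + t) ≡ (b + t) + s
      rearrange = solve-∀

  topRimHook-last : at as 0 + length as ≤ b → b < a + length as →
    ∃ λ mu → TopRimHook (a ∷ as) mu × beta mu ↭ b ∷ beta as
  topRimHook-last {as} {b} {a} ≤b b< =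
    (b ∸ length as) ∷ as ,
    last (ℕ.m+n≤o⇒m≤o∸n (at as 0) ≤b) (ℕ.+-cancelʳ-< (length as) _ a (subst (_< a + length as) (sym b≡) b<)) ,
    ↭-reflexive (cong (_∷ beta as) b≡)
    where
    b≡ : b ∸ length as + length as ≡ b
    b≡ = ℕ.m∸n+n≡m (ℕ.≤-trans (ℕ.m≤n+m (length as) (at as 0)) ≤b)

  topRimHook-exists : Decreasing (a ∷ as) → b < a + length as → b ∉ beta as →
    ∃ λ mu → TopRimHook (a ∷ as) mu × beta mu ↭ b ∷ beta as
  topRimHook-exists {as = []} _ b< _ = topRimHook-last z≤n b<
  topRimHook-exists {as = a₁ ∷ as} {b} (a₁≤a , dec) b< b∉ with ℕ.<-cmp b (a₁ + length as)
  ... | tri≈ _ b≡ _ = contradiction (here b≡) b∉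
  ... | tri> _ _ b> = topRimHook-last (subst (_≤ b) (sym (ℕ.+-suc a₁ (length as))) b>) b<
  ... | tri< b<₁ _ _ with topRimHook-exists dec b<₁ (b∉ ∘ there)
  topRimHook-exists {as = zero ∷ _} _ _ _ | _ | _ , hook , _ = contradiction (topRimHook-head hook) ℕ.n≮0
  topRimHook-exists {as = suc _ ∷ _} (a₁≤a , _) _ _ | _ | mu , hook , perm =
    _ ∷ mu , next a₁≤a hook , beta-next (topRimHook-length hook) perm

  rimHook-exists : ∀ lam → Decreasing lam → d ∈ beta lam → b < d → b ∉ beta lam →
    ∃ λ mu → RimHook lam mu × Replaces d b (beta lam) (beta mu)
  rimHook-exists (a ∷ as) dec (here refl) b<d b∉
    with mu , hook , perm ← topRimHook-exists dec b<d (b∉ ∘ there) = mu , top hook , replaces ↭-refl perm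
  rimHook-exists (a ∷ as) dec (there d∈) b<d b∉
    with mu , hook , repl ← rimHook-exists as (Decreasing-tail dec) d∈ b<d (b∉ ∘ there) =
    a ∷ mu , skip hook , replaces-∷ (rimHook-length hook) repl

  removesStrip-exists : ∀ lam → 1 ≤ t → Decreasing lam → b + t ∈ beta lam → b ∉ beta lam →
    ∃ (RemovesStrip t lam)
  removesStrip-exists {t} {b} lam 1≤t dec b+t∈ b∉
    with mu , hook , repl ← rimHook-exists lam dec b+t∈ (ℕ.m<m+n b 1≤t) b∉ =
    mu , length≡ strip , decreasing strip , below strip , sum≡ , no-square strip , interval strip , edge strip
    where
    strip : BorderStrip lam mu
    strip = rimHook⇒borderStrip dec hook
    sum≡ : sum lam ≡ sum mu + t
    sum≡ = ℕ.+-cancelˡ-≡ b _ _ (trans (replaces-sum (length≡ strip) repl) (rearrange b t (sum mu)))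
      where
      rearrange : ∀ b t s → (b + t) + s ≡ b + (s + t)
      rearrange = solve-∀

module Residues (t : ℕ) .{{t≢0 : NonZero t}} where
  open ≡ using (refl; sym; trans)
  open BorderStrips using (replaces; removesStrip-beta; removesStrip-exists)
  open DecMembership ℕ._≟_ using (_∈?_)

  0<t : 0 < t
  0<t = ℕ.>-nonZero⁻¹ t

  residue? : ∀ i → Decidable (λ b → b % t ≡ i)
  residue? i b = b % t ℕ.≟ i

  class : ℕ → List ℕ → List ℕ
  class i = filter (residue? i)

  [t*q+i]%t≡i : ∀ q {i} → i < t → (t * q + i) % t ≡ i
  [t*q+i]%t≡i q i<t = trans (ℕ.%-remove-+ˡ _ (m∣m*n q)) (ℕ.m<n⇒m%n≡m i<t)

  [t*q+i]/t≡q : ∀ q {i} → i < t → (t * q + i) / t ≡ q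
  [t*q+i]/t≡q q {i} i<t = begin
    (t * q + i) / t   ≡⟨ ℕ.+-distrib-/-∣ˡ i (m∣m*n q) ⟩
    t * q / t + i / t ≡⟨ cong₂ _+_ (trans (cong (_/ t) (ℕ.*-comm t q)) (ℕ.m*n/n≡m q t)) (ℕ.m<n⇒m/n≡0 i<t) ⟩
    q + 0             ≡⟨ ℕ.+-identityʳ q ⟩
    q                 ∎
    where open ≡.≡-Reasoning

  /-strict-on-residue : ∀ {d e} → e % t ≡ d % t → e < d → e / t < d / t
  /-strict-on-residue {d} {e} e%t≡d%t e<d = ℕ.*-cancelʳ-< t _ _ (ℕ.+-cancelˡ-< (d % t) _ _
    (subst₂ _<_ (trans (ℕ.m≡m%n+[m/n]*n e t) (cong (_+ e / t * t) e%t≡d%t)) (ℕ.m≡m%n+[m/n]*n d t) e<d))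

  t*n≤e⇒n≤e/t : ∀ n {e} → t * n ≤ e → n ≤ e / t
  t*n≤e⇒n≤e/t n {e} t*n≤e = subst (_≤ e / t)
    (trans (cong (_/ t) (ℕ.*-comm t n)) (ℕ.m*n/n≡m n t)) (ℕ./-monoˡ-≤ t t*n≤e)

  class-residue : ∀ i B → All (λ b → b % t ≡ i) (class i B)
  class-residue i = All.all-filter (residue? i)

  classQuotients : ℕ → List ℕ → List ℕ
  classQuotients i B = map (_/ t) (class i B)

  classQuotients-strict : ∀ i {B} → AllPairs ℕ._>_ B → AllPairs ℕ._>_ (classQuotients i B)
  classQuotients-strict i {B} B> = AllPairs.map⁺ (strict (class-residue i B) (AllPairs.filter⁺ (residue? i) B>))
    where
    strict : ∀ {B} → All (λ b → b % t ≡ i) B → AllPairs ℕ._>_ B → AllPairs (λ d e → e / t < d / t) B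
    strict [] [] = []
    strict (d%t≡i ∷ B%t≡i) (d> ∷ B>) = All.zipWith
      (λ (e%t≡i , e<d) → /-strict-on-residue (trans e%t≡i (sym d%t≡i)) e<d) (B%t≡i , d>) ∷ strict B%t≡i B>

  -- Residues of beta sets and cores

  class-size-removesStrip : ∀ i lam mu → RemovesStrip t lam mu →
    length (class i (beta lam)) ≡ length (class i (beta mu))
  class-size-removesStrip i lam mu removes
    with b , replaces {rest} old new ← removesStrip-beta lam mu 0<t removes = begin
    length (class i (beta lam))       ≡⟨ Perm.↭-length (Perm.filter-↭ (residue? i) old) ⟩
    length (class i (b + t ∷ rest))   ≡⟨ same-residue ⟩
    length (class i (b ∷ rest))       ≡⟨ Perm.↭-length (Perm.filter-↭ (residue? i) new) ⟨
    length (class i (beta mu))        ∎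
    where
    open ≡.≡-Reasoning
    same-residue : length (class i (b + t ∷ rest)) ≡ length (class i (b ∷ rest))
    same-residue rewrite ℕ.[m+n]%n≡m%n b t {{t≢0}} with does (b % t ℕ.≟ i)
    ... | true = refl
    ... | false = refl

  reach-class-size : ∀ i {lam κ} → Reach t lam κ → length (class i (beta lam)) ≡ length (class i (beta κ))
  reach-class-size i done = refl
  reach-class-size i {lam} (step {mu = mu} removes reach) =
    trans (class-size-removesStrip i lam mu removes) (reach-class-size i reach)

  reach-decreasing : ∀ {lam κ} → Decreasing lam → Reach t lam κ → Decreasing κ
  reach-decreasing dec done = dec
  reach-decreasing _ (step (_ , dec , _) reach) = reach-decreasing dec reach

  reach-length : ∀ {lam κ} → Reach t lam κ → length κ ≡ length lam
  reach-length done = refl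
  reach-length (step (len , _) reach) = trans (reach-length reach) len

  Flush : List ℕ → Set
  Flush B = ∀ b → b + t ∈ B → b ∈ B

  flush-descend : ∀ {B} → Flush B → ∀ b k → b + k * t ∈ B → b ∈ B
  flush-descend {B} flush b zero b∈ = subst (_∈ B) (ℕ.+-identityʳ b) b∈
  flush-descend {B} flush b (suc k) b∈ = flush-descend flush b k (flush _ (subst (_∈ B) (rearrange b k t) b∈))
    where
    rearrange : ∀ b k t → b + (t + k * t) ≡ (b + k * t) + t
    rearrange = solve-∀

  flush-class-size : ∀ {B e} → Flush B → e ∈ B → e / t < length (class (e % t) B)
  flush-class-size {B} {e} flush e∈ = ℕ.≤-trans (ℕ.≤-reflexive (sym length-runner))
    (Unique-⊆⇒length≤ (Unique.map⁺ below-injective (Unique.upTo⁺ (suc q))) runner⊆class)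
    where
    q = e / t
    below : ℕ → ℕ
    below j = e % t + j * t
    length-runner : length (map below (upTo (suc q))) ≡ suc q
    length-runner = trans (List.length-map below (upTo (suc q))) (List.length-upTo (suc q))
    below-injective : ∀ {i j} → below i ≡ below j → i ≡ j
    below-injective {i} {j} eq = ℕ.*-cancelʳ-≡ i j t (ℕ.+-cancelˡ-≡ (e % t) _ _ eq)
    e≡ : ∀ {j} → j ≤ q → e ≡ below j + (q ∸ j) * t
    e≡ {j} j≤q = begin
      e                                 ≡⟨ ℕ.m≡m%n+[m/n]*n e t ⟩
      e % t + q * t                     ≡⟨ cong (λ k → e % t + k * t) (ℕ.m+[n∸m]≡n j≤q) ⟨
      e % t + (j + (q ∸ j)) * t         ≡⟨ distribute (e % t) j (q ∸ j) t ⟩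
      below j + (q ∸ j) * t             ∎
      where
      open ≡.≡-Reasoning
      distribute : ∀ r j k t → r + (j + k) * t ≡ (r + j * t) + k * t
      distribute = solve-∀
    runner⊆class : ∀ {b} → b ∈ map below (upTo (suc q)) → b ∈ class (e % t) B
    runner⊆class b∈ with j , j∈ , refl ← ∈-map⁻ below {xs = upTo (suc q)} b∈ = ∈-filter⁺ (residue? (e % t))
      (flush-descend flush (below j) (q ∸ j) (subst (_∈ B) (e≡ (ℕ.≤-pred (∈-upTo⁻ j∈))) e∈))
      (trans (ℕ.[m+kn]%n≡m%n (e % t) j t) (ℕ.m%n%n≡m%n e t))

  core-flush : ∀ {κ} → Decreasing κ → (∀ mu → ¬ RemovesStrip t κ mu) → Flush (beta κ)
  core-flush {κ} dec core b b+t∈ with b ∈? beta κ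
  ... | yes b∈ = b∈
  ... | no b∉ with mu , removes ← removesStrip-exists κ 0<t dec b+t∈ b∉ = contradiction removes (core mu)

  -- The columns with residues in L meet only n rows for each residue, and the row of ones.
  Crowded : ℕ → List ℕ → Set
  Crowded n B = ∃ λ L → Unique L × length L * n + 2 ≤ length (concatMap (λ i → class i B) L)

  module _ {n : ℕ} {lam κ : List ℕ} (dec : Decreasing lam) (isCore : IsCore t lam κ) where

    private
      reach : Reach t lam κ
      reach = proj₁ isCore

      classOf : ℕ → List ℕ
      classOf e = class (e % t) (beta lam)

      large-class : ∀ {e} → e ∈ beta κ → e / t < length (classOf e)
      large-class {e} e∈ = subst (e / t <_) (sym (reach-class-size (e % t) reach))
        (flush-class-size (core-flush (reach-decreasing dec reach) (proj₂ isCore)) e∈)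

    same-residue-crowded : ∀ {d e} → d ∈ beta κ → t * n ≤ e → e < d → e % t ≡ d % t → Crowded n (beta lam)
    same-residue-crowded {d} {e} d∈ tn≤e e<d e%t≡d%t = d % t ∷ [] , [] ∷ [] , (begin
      1 * n + 2                  ≡⟨ rearrange n ⟩
      suc (suc n)                ≤⟨ s≤s (ℕ.≤-<-trans (t*n≤e⇒n≤e/t n tn≤e) (/-strict-on-residue e%t≡d%t e<d)) ⟩
      suc (d / t)                ≤⟨ large-class d∈ ⟩
      length (classOf d)         ≡⟨ cong length (List.++-identityʳ (classOf d)) ⟨
      length (classOf d ++ [])   ∎)
      where
      open ℕ.≤-Reasoning
      rearrange : ∀ n → 1 * n + 2 ≡ suc (suc n)
      rearrange = solve-∀

    distinct-residues-crowded : ∀ {d e} → d ∈ beta κ → e ∈ beta κ → t * n ≤ d → t * n ≤ e → e % t ≢ d % t →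
      Crowded n (beta lam)
    distinct-residues-crowded {d} {e} d∈ e∈ tn≤d tn≤e e%t≢d%t =
      e % t ∷ d % t ∷ [] , (e%t≢d%t ∷ []) ∷ [] ∷ [] , (begin
      2 * n + 2                                  ≡⟨ rearrange n ⟩
      suc n + suc n                              ≤⟨ ℕ.+-mono-≤ (above-n e∈ tn≤e) (above-n d∈ tn≤d) ⟩
      length (classOf e) + length (classOf d)    ≡⟨ List.length-++ (classOf e) ⟨
      length (classOf e ++ classOf d)
        ≡⟨ cong (λ l → length (classOf e ++ l)) (List.++-identityʳ (classOf d)) ⟨
      length (classOf e ++ classOf d ++ [])      ∎)
      where
      open ℕ.≤-Reasoning
      rearrange : ∀ n → 2 * n + 2 ≡ suc n + suc n
      rearrange = solve-∀
      above-n : ∀ {e} → e ∈ beta κ → t * n ≤ e → n < length (classOf e)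
      above-n e∈ tn≤e = ℕ.≤-<-trans (t*n≤e⇒n≤e/t n tn≤e) (large-class e∈)

    long-core-crowded : length lam ≡ t * n + 1 → 1 < partLength κ → Crowded n (beta lam)
    long-core-crowded len long
      with d , e , d∈ , e∈ , tn≤e , e<d ←
        two-large-betas κ (trans (reach-length reach) len) (reach-decreasing dec reach) long
      with e % t ℕ.≟ d % t
    ... | yes e%t≡d%t = same-residue-crowded d∈ tn≤e e<d e%t≡d%t
    ... | no e%t≢d%t = distinct-residues-crowded d∈ e∈ (ℕ.≤-trans tn≤e (ℕ.<⇒≤ e<d)) tn≤e e%t≢d%t

  -- Beta sets of one-row partitions

  runner-/ : ∀ {i} → i < t → ∀ n → map (_/ t) (runner t i n) ≡ downFrom n
  runner-/ i<t zero = refl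
  runner-/ i<t (suc n) = cong₂ _∷_ ([t*q+i]/t≡q n i<t) (runner-/ i<t n)

  class-downFrom : ∀ {i} → i < t → ∀ n → class i (downFrom (t * n)) ≡ runner t i n
  class-downFrom {i} i<t zero = cong (class i ∘ downFrom) (ℕ.*-zeroʳ t)
  class-downFrom {i} i<t (suc n) = begin
    class i (downFrom (t * suc n))
      ≡⟨ cong (class i) (trans (cong downFrom (ℕ.*-suc t n)) (downFrom-+ t (t * n))) ⟩
    class i (map (t * n +_) (downFrom t) ++ downFrom (t * n))
      ≡⟨ List.filter-++ (residue? i) (map (t * n +_) (downFrom t)) (downFrom (t * n)) ⟩
    class i (map (t * n +_) (downFrom t)) ++ class i (downFrom (t * n))
      ≡⟨ cong₂ _++_ block (class-downFrom i<t n) ⟩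
    runner t i (suc n) ∎
    where
    open ≡.≡-Reasoning
    block : class i (map (t * n +_) (downFrom t)) ≡ t * n + i ∷ []
    block = filter-singleton (residue? i) (Unique.map⁺ (ℕ.+-cancelˡ-≡ (t * n) _ _) (Unique.downFrom⁺ t))
      (∈-map⁺ (t * n +_) (∈-downFrom⁺ i<t)) ([t*q+i]%t≡i n i<t) only
      where
      only : ∀ {b} → b ∈ map (t * n +_) (downFrom t) → b % t ≡ i → b ≡ t * n + i
      only b∈ b%t≡i with j , j∈ , refl ← ∈-map⁻ (t * n +_) b∈ =
        cong (t * n +_) (trans (sym ([t*q+i]%t≡i n (∈-downFrom⁻ j∈))) b%t≡i)

  rowBeta : ℕ → ℕ → List ℕ
  rowBeta c n = t * n + c ∷ downFrom (t * n)

  beta-row : ∀ c n → beta (c ∷ replicate (t * n) 0) ≡ rowBeta c n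
  beta-row c n = cong₂ _∷_
    (trans (cong (c +_) (List.length-replicate (t * n))) (ℕ.+-comm c (t * n))) (beta-replicate-0 (t * n))

  class-rowBeta-≡ : ∀ {c} n → c < t → class c (rowBeta c n) ≡ runner t c (suc n)
  class-rowBeta-≡ {c} n c<t = trans
    (List.filter-accept (residue? c) ([t*q+i]%t≡i n c<t)) (cong (t * n + c ∷_) (class-downFrom c<t n))

  class-rowBeta-≢ : ∀ {c i} n → c < t → i < t → c ≢ i → class i (rowBeta c n) ≡ runner t i n
  class-rowBeta-≢ {i = i} n c<t i<t c≢i = trans
    (List.filter-reject (residue? i) (λ eq → c≢i (trans (sym ([t*q+i]%t≡i n c<t)) eq))) (class-downFrom i<t n)

  RowCoreSizes : ℕ → ℕ → List ℕ → Set
  RowCoreSizes c n B = length (class c B) ≡ suc n × (∀ {i} → i < t → c ≢ i → length (class i B) ≡ n)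

  rowBeta-sizes : ∀ {c} n → c < t → RowCoreSizes c n (rowBeta c n)
  rowBeta-sizes {c} n c<t =
    trans (cong length (class-rowBeta-≡ n c<t)) (List.length-applyDownFrom _ (suc n)) ,
    λ i<t c≢i → trans (cong length (class-rowBeta-≢ n c<t i<t c≢i)) (List.length-applyDownFrom _ n)

  row-core-sizes : ∀ {c n lam} → c < t → Reach t lam (c ∷ replicate (t * n) 0) → RowCoreSizes c n (beta lam)
  row-core-sizes {c} {n} {lam} c<t reach =
    trans (to-row c) (proj₁ sizes) , λ {i} i<t c≢i → trans (to-row i) (proj₂ sizes i<t c≢i)
    where
    sizes : RowCoreSizes c n (rowBeta c n)
    sizes = rowBeta-sizes n c<t
    to-row : ∀ i → length (class i (beta lam)) ≡ length (class i (rowBeta c n))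
    to-row i = trans (reach-class-size i reach) (cong (length ∘ class i) (beta-row c n))

  -- The residues in the order in which σ^c lists them

  others : ℕ → List ℕ
  others c = filter (λ i → ¬? (i ℕ.≟ c)) (upTo t)

  keep≡others : ∀ c → keep (λ i → not (i ≡ᵇ c)) (upTo t) ≡ others c
  keep≡others c = keep≡filter (λ i → ¬? (i ℕ.≟ c)) (upTo t)

  above : ℕ → List ℕ
  above c = applyUpTo (λ j → c + suc j) (t ∸ suc c)

  upTo-split : ∀ {c} → c < t → upTo t ≡ upTo c ++ c ∷ above c
  upTo-split {c} c<t = begin
    upTo t                        ≡⟨ cong upTo (trans (ℕ.+-suc c (t ∸ suc c)) (ℕ.m+[n∸m]≡n c<t)) ⟨
    upTo (c + suc (t ∸ suc c))    ≡⟨ applyUpTo-+ id c (suc (t ∸ suc c)) ⟩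
    upTo c ++ c + 0 ∷ above c     ≡⟨ cong (λ d → upTo c ++ d ∷ above c) (ℕ.+-identityʳ c) ⟩
    upTo c ++ c ∷ above c         ∎
    where open ≡.≡-Reasoning

  others-split : ∀ {c} → c < t → others c ≡ upTo c ++ above c
  others-split {c} c<t = begin
    filter ≢c? (upTo t)                       ≡⟨ cong (filter ≢c?) (upTo-split c<t) ⟩
    filter ≢c? (upTo c ++ c ∷ above c)        ≡⟨ List.filter-++ ≢c? (upTo c) (c ∷ above c) ⟩
    filter ≢c? (upTo c) ++ filter ≢c? (c ∷ above c)
      ≡⟨ cong₂ _++_ (List.filter-all ≢c? (All.map ℕ.<⇒≢ (All.all-upTo c)))
           (trans (List.filter-reject ≢c? (λ c≢c → c≢c refl))
             (List.filter-all ≢c? (All.applyUpTo⁺₂ (λ j → c + suc j) (t ∸ suc c) (λ j → ℕ.m+1+n≢m c)))) ⟩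
    upTo c ++ above c                         ∎
    where
    open ≡.≡-Reasoning
    ≢c? : Decidable (_≢ c)
    ≢c? i = ¬? (i ℕ.≟ c)

  c∷others↭upTo : ∀ {c} → c < t → c ∷ others c ↭ upTo t
  c∷others↭upTo {c} c<t = ↭-trans (↭-reflexive (cong (c ∷_) (others-split c<t)))
    (↭-trans (↭-sym (Perm.shift c (upTo c) (above c))) (↭-reflexive (sym (upTo-split c<t))))

  length-others : ∀ {c} → c < t → length (others c) ≡ t ∸ 1
  length-others c<t = cong (_∸ 1) (trans (Perm.↭-length (c∷others↭upTo c<t)) (List.length-upTo t))

  others-< : ∀ c → All (_< t) (others c)
  others-< c = All.filter⁺ _ (All.all-upTo t)

  others-≢ : ∀ c → All (c ≢_) (others c)
  others-≢ c = All.map (λ i≢c → i≢c ∘ sym) (All.all-filter (λ i → ¬? (i ℕ.≟ c)) (upTo t))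

  others-unique : ∀ c → Unique (others c)
  others-unique c = Unique.filter⁺ _ (Unique.upTo⁺ t)

  arrange : ℕ → List ℕ → List ℕ
  arrange c B = concatMap (λ i → class i B) (c ∷ others c)

  arrange-rowBeta : ∀ {c} n → c < t →
    arrange c (rowBeta c n) ≡ runner t c (suc n) ++ concatMap (λ i → runner t i n) (others c)
  arrange-rowBeta {c} n c<t = cong₂ _++_ (class-rowBeta-≡ n c<t)
    (concatMap-cong-local (All.zipWith
      (λ (i<t , c≢i) → class-rowBeta-≢ n c<t i<t c≢i) (others-< c , others-≢ c)))

  positions : List ℕ → ℕ → List ℕ
  positions lam i = filter (residue? i ∘ at (beta lam)) (upTo (length lam))

  sigmaList≡ : ∀ c lam → sigmaList t c lam ≡ concatMap (positions lam) (c ∷ others c)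
  sigmaList≡ c lam = trans (cong (λ l → concatMap (λ i → posRes t i lam) (c ∷ l)) (keep≡others c))
    (List.concatMap-cong (λ i → keep≡filter (residue? i ∘ at (beta lam)) (upTo (length lam))) (c ∷ others c))

  map-sigmaList : ∀ c lam → map (at (beta lam)) (sigmaList t c lam) ≡ arrange c (beta lam)
  map-sigmaList c lam = begin
    map β (sigmaList t c lam)                       ≡⟨ cong (map β) (sigmaList≡ c lam) ⟩
    map β (concatMap (positions lam) (c ∷ others c)) ≡⟨ List.map-concatMap β (positions lam) (c ∷ others c) ⟩
    concatMap (map β ∘ positions lam) (c ∷ others c) ≡⟨ List.concatMap-cong map-positions (c ∷ others c) ⟩
    arrange c (beta lam)                            ∎
    where
    open ≡.≡-Reasoning
    β = at (beta lam)
    map-positions : ∀ i → map β (positions lam i) ≡ class i (beta lam)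
    map-positions i = trans (sym (filter-map (residue? i) β (upTo (length lam))))
      (cong (class i) (trans (cong (map β ∘ upTo) (sym (length-beta lam))) (map-at (beta lam))))

  sigmaList-↭ : ∀ {c} lam → c < t → sigmaList t c lam ↭ upTo (length lam)
  sigmaList-↭ {c} lam c<t = ↭-trans (↭-reflexive (sigmaList≡ c lam))
    (↭-trans (concatMap-fibres ℕ._≟_ residue (upTo (length lam)) (others-≢ c ∷ others-unique c))
      (↭-reflexive (List.filter-all _ (All.tabulate λ {j} _ →
        Perm.∈-resp-↭ (↭-sym (c∷others↭upTo c<t)) (∈-upTo⁺ (ℕ.m%n<n (at (beta lam) j) t))))))
    where
    residue : ℕ → ℕ
    residue j = at (beta lam) j % t

  quotient≡fromBeta : ∀ i lam → quotient t i lam ≡ fromBeta (classQuotients i (beta lam))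
  quotient≡fromBeta i lam rewrite keep≡filter (residue? i) (beta lam) =
    subst (λ k → zipWith (λ b j → (b + suc j) ∸ k) Q (upTo k) ≡ fromBeta Q)
      (List.length-map (_/ t) (class i (beta lam))) (zipWith-fromBeta 0 (length Q) Q (λ _ → refl) refl)
    where
    Q = classQuotients i (beta lam)

  exponents-quotient : ∀ {N} i lam → Decreasing lam → length (class i (beta lam)) ≡ N →
    exponents N (quotient t i lam) ≡ classQuotients i (beta lam)
  exponents-quotient {N} i lam dec size = begin
    exponents N (quotient t i lam)   ≡⟨ cong (exponents N) (quotient≡fromBeta i lam) ⟩
    exponents N (fromBeta Q)         ≡⟨ exponents≡beta (trans (length-fromBeta Q) length-Q) ⟩
    beta (fromBeta Q)                ≡⟨ beta-fromBeta (classQuotients-strict i (beta-strict lam dec)) ⟩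
    Q                                ∎
    where
    open ≡.≡-Reasoning
    Q = classQuotients i (beta lam)
    length-Q : length Q ≡ N
    length-Q = trans (List.length-map (_/ t) (class i (beta lam))) size

module AlternatingForms {a ℓ} (R : CommutativeRing a ℓ) where
  open CommutativeRing R renaming (_+_ to _⊕_; _*_ to _·_)
  open import Algebra.Properties.CommutativeSemiring.Exp commutativeSemiring
    using (_^_; ^-homo-*; ^-assocʳ; ^-congˡ)
  open import Algebra.Properties.Ring ring using (-1*x≈-x; -‿involutive)
  open import Algebra.Solver.Ring.NaturalCoefficients.Default commutativeSemiring
    using (solve; _:=_; _:+_; _:*_)
  open import Relation.Binary.Reasoning.Setoid setoid

  private variable
    b e : Level
    A : Set b
    E : Set e

  -- Signs are factors -1# rather than negations: the solver for commutative semirings treats -1# as a variable.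
  -1# : Carrier
  -1# = - 1#

  x-x≈0 : ∀ x → x ⊕ -1# · x ≈ 0#
  x-x≈0 x = trans (+-congˡ (-1*x≈-x x)) (-‿inverseʳ x)

  -1·-1≈1 : -1# · -1# ≈ 1#
  -1·-1≈1 = trans (-1*x≈-x -1#) (-‿involutive 1#)

  -1·-1·x≈x : ∀ x → -1# · (-1# · x) ≈ x
  -1·-1·x≈x x = trans (sym (*-assoc _ _ _)) (trans (*-congʳ -1·-1≈1) (*-identityˡ x))

  sign : ℕ → Carrier
  sign k = -1# ^ k

  sign-+ : ∀ m n → sign (m + n) ≈ sign m · sign n
  sign-+ = ^-homo-* -1#

  sign-self-inverse : ∀ k → sign k · sign k ≈ 1#
  sign-self-inverse zero = *-identityˡ 1#
  sign-self-inverse (suc k) = begin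
    (-1# · sign k) · (-1# · sign k)
      ≈⟨ solve 2 (λ m s → (m :* s) :* (m :* s) := (m :* m) :* (s :* s)) refl -1# (sign k) ⟩
    (-1# · -1#) · (sign k · sign k)
      ≈⟨ *-cong -1·-1≈1 (sign-self-inverse k) ⟩
    1# · 1#
      ≈⟨ *-identityˡ 1# ⟩
    1# ∎

  sign-·-sign-· : ∀ k x → sign k · (sign k · x) ≈ x
  sign-·-sign-· k x = trans (sym (*-assoc _ _ _)) (trans (*-congʳ (sign-self-inverse k)) (*-identityˡ x))

  sign-square : ∀ n → sign (n * n) ≈ sign n
  sign-square zero = refl
  sign-square (suc n) = *-congˡ (begin
    sign (n + n * suc n)                ≡⟨ cong (λ k → sign (n + k)) (ℕ.*-suc n n) ⟩
    sign (n + (n + n * n))              ≈⟨ trans (sign-+ n _) (*-congˡ (sign-+ n _)) ⟩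
    sign n · (sign n · sign (n * n))    ≈⟨ sign-·-sign-· n _ ⟩
    sign (n * n)                        ≈⟨ sign-square n ⟩
    sign n                              ∎)

  sign-*-square : ∀ m n → sign (m * (n * n)) ≈ sign (m * n)
  sign-*-square m n = begin
    sign (m * (n * n))  ≡⟨ cong sign (ℕ.*-comm m (n * n)) ⟩
    sign (n * n * m)    ≈⟨ ^-assocʳ -1# (n * n) m ⟨
    sign (n * n) ^ m    ≈⟨ ^-congˡ m (sign-square n) ⟩
    sign n ^ m          ≈⟨ ^-assocʳ -1# n m ⟩
    sign (n * m)        ≡⟨ cong sign (ℕ.*-comm n m) ⟩
    sign (m * n)        ∎

  sign-combine : ∀ k m n w → sign (m * (n * n) + w) ≈ sign k · (sign (k + m * n) · sign w)
  sign-combine k m n w = begin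
    sign (m * (n * n) + w)                        ≈⟨ sign-+ (m * (n * n)) w ⟩
    sign (m * (n * n)) · sign w                   ≈⟨ *-congʳ (sign-*-square m n) ⟩
    sign (m * n) · sign w                         ≈⟨ *-congʳ (sign-·-sign-· k _) ⟨
    (sign k · (sign k · sign (m * n))) · sign w   ≈⟨ *-congʳ (*-congˡ (sign-+ k (m * n))) ⟨
    (sign k · sign (k + m * n)) · sign w          ≈⟨ *-assoc _ _ _ ⟩
    sign k · (sign (k + m * n) · sign w)          ∎

  Form : Set e → Set _
  Form E = List E → Carrier

  record Antisymmetric {E : Set e} (g : Form E) : Set (e ⊔ ℓ) where
    field
      swapped : ∀ p u v q → g (p ++ u ∷ v ∷ q) ≈ -1# · g (p ++ v ∷ u ∷ q)

  record Alternating {E : Set e} (g : Form E) : Set (e ⊔ ℓ) where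
    field
      antisymmetric : Antisymmetric g
      repeated      : ∀ p u q → g (p ++ u ∷ u ∷ q) ≈ 0#

  open Antisymmetric
  open Alternating

  antisymmetric-∷ : {g : Form E} → Antisymmetric g → ∀ x → Antisymmetric (g ∘ (x ∷_))
  antisymmetric-∷ anti x .swapped p = swapped anti (x ∷ p)

  antisymmetric-++ : {g : Form E} → Antisymmetric g → ∀ p → Antisymmetric (g ∘ (p ++_))
  antisymmetric-++ anti [] = anti
  antisymmetric-++ anti (x ∷ p) = antisymmetric-++ (antisymmetric-∷ anti x) p

  antisymmetric-map : {g : Form E} → Antisymmetric g → ∀ (f : A → E) → Antisymmetric (g ∘ map f)
  antisymmetric-map anti f .swapped p u v q
    rewrite List.map-++ f p (u ∷ v ∷ q) | List.map-++ f p (v ∷ u ∷ q) =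
    swapped anti (map f p) (f u) (f v) (map f q)

  move-past : {g : Form E} → Antisymmetric g → ∀ u ys zs →
    g (u ∷ ys ++ zs) ≈ sign (length ys) · g (ys ++ u ∷ zs)
  move-past anti u [] zs = sym (*-identityˡ _)
  move-past {g = g} anti u (y ∷ ys) zs = begin
    g (u ∷ y ∷ ys ++ zs)                            ≈⟨ swapped anti [] u y (ys ++ zs) ⟩
    -1# · g (y ∷ u ∷ ys ++ zs)                      ≈⟨ *-congˡ (move-past (antisymmetric-∷ anti y) u ys zs) ⟩
    -1# · (sign (length ys) · g (y ∷ ys ++ u ∷ zs)) ≈⟨ *-assoc _ _ _ ⟨
    sign (suc (length ys)) · g (y ∷ ys ++ u ∷ zs)   ∎

  move-to-front : {g : Form E} → Antisymmetric g → ∀ ys u zs →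
    g (ys ++ u ∷ zs) ≈ sign (length ys) · g (u ∷ ys ++ zs)
  move-to-front anti ys u zs =
    trans (sym (sign-·-sign-· (length ys) _)) (*-congˡ (sym (move-past anti u ys zs)))

  move-block : {g : Form E} → Antisymmetric g → ∀ xs ys zs →
    g (xs ++ ys ++ zs) ≈ sign (length xs * length ys) · g (ys ++ xs ++ zs)
  move-block anti [] ys zs = sym (*-identityˡ _)
  move-block {g = g} anti (x ∷ xs) ys zs = begin
    g (x ∷ xs ++ ys ++ zs)
      ≈⟨ move-block (antisymmetric-∷ anti x) xs ys zs ⟩
    sign (length xs * length ys) · g (x ∷ ys ++ xs ++ zs)
      ≈⟨ *-congˡ (move-past anti x ys (xs ++ zs)) ⟩
    sign (length xs * length ys) · (sign (length ys) · g (ys ++ x ∷ xs ++ zs))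
      ≈⟨ solve 3 (λ u v w → u :* (v :* w) := (v :* u) :* w) refl _ _ _ ⟩
    (sign (length ys) · sign (length xs * length ys)) · g (ys ++ x ∷ xs ++ zs)
      ≈⟨ *-congʳ (sign-+ (length ys) _) ⟨
    sign (length ys + length xs * length ys) · g (ys ++ x ∷ xs ++ zs) ∎

  repeated-∈ : {g : Form E} → Alternating g → ∀ {u l} → u ∈ l → g (u ∷ l) ≈ 0#
  repeated-∈ {g = g} alt {u} u∈l with p , q , ≡.refl ← ∈-∃++ u∈l = begin
    g (u ∷ p ++ u ∷ q)                     ≈⟨ move-past (antisymmetric alt) u p (u ∷ q) ⟩
    sign (length p) · g (p ++ u ∷ u ∷ q)   ≈⟨ *-congˡ (repeated alt p u q) ⟩
    sign (length p) · 0#                   ≈⟨ zeroʳ _ ⟩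
    0#                                     ∎

  sort-sign : {g : Form ℕ} → Antisymmetric g → ∀ {s σ} → AllPairs _<_ s → σ ↭ s →
    g σ ≈ sign (inversions σ) · g s
  sort-sign anti [] σ↭s with ≡.refl ← Perm.↭-empty-inv σ↭s = sym (*-identityˡ _)
  sort-sign {g} anti {u ∷ s} (u<s ∷ s↗) σ↭s
    with p , q , ≡.refl ← ∈-∃++ (Perm.∈-resp-↭ (↭-sym σ↭s) (here ≡.refl)) = begin
      g (p ++ u ∷ q)
        ≈⟨ move-to-front anti p u q ⟩
      sign (length p) · g (u ∷ p ++ q)
        ≈⟨ *-congˡ (sort-sign (antisymmetric-∷ anti u) s↗ p++q↭s) ⟩
      sign (length p) · (sign (inversions (p ++ q)) · g (u ∷ s))
        ≈⟨ trans (*-congʳ (sign-+ (length p) _)) (*-assoc _ _ _) ⟨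
      sign (length p + inversions (p ++ q)) · g (u ∷ s)
        ≡⟨ cong (λ k → sign k · g (u ∷ s)) (inversions-insert-min p u q (Perm.All-resp-↭ (↭-sym p++q↭s) u<s)) ⟨
      sign (inversions (p ++ u ∷ q)) · g (u ∷ s) ∎
    where
    p++q↭s : p ++ q ↭ s
    p++q↭s = Perm.drop-mid p [] σ↭s

  interleave : {g : Form E} → Antisymmetric g → ∀ (X : A → E) (C : A → List E) {m} L →
    All (λ i → length (C i) ≡ m) L →
    g (map X (reverse L) ++ concatMap C L)
      ≈ sign (triangle (length L) * suc m) · g (concatMap (λ i → X i ∷ C i) L)
  interleave anti X C [] _ = sym (*-identityˡ _)
  interleave {g = g} anti X C {m} (i ∷ L) (|Ci|≡m ∷ |C|≡m) = begin
    g (map X (reverse (i ∷ L)) ++ C i ++ concatMap C L)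
      ≡⟨ cong g front ⟩
    g (Xs ++ (X i ∷ C i) ++ concatMap C L)
      ≈⟨ move-block anti Xs (X i ∷ C i) (concatMap C L) ⟩
    sign (length Xs * suc (length (C i))) · g ((X i ∷ C i) ++ Xs ++ concatMap C L)
      ≈⟨ *-cong (reflexive (cong₂ (λ k l → sign (k * suc l)) length-Xs |Ci|≡m))
           (interleave (antisymmetric-++ anti (X i ∷ C i)) X C L |C|≡m) ⟩
    sign (length L * suc m) · (sign (triangle (length L) * suc m) · woven)
      ≈⟨ trans (*-congʳ (sign-+ (length L * suc m) _)) (*-assoc _ _ _) ⟨
    sign (length L * suc m + triangle (length L) * suc m) · woven
      ≡⟨ cong (λ k → sign k · woven) (ℕ.*-distribʳ-+ (suc m) (length L) _) ⟨
    sign (triangle (suc (length L)) * suc m) · woven ∎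
    where
    woven = g (concatMap (λ i → X i ∷ C i) (i ∷ L))
    Xs = map X (reverse L)
    length-Xs : length Xs ≡ length L
    length-Xs = ≡.trans (List.length-map X (reverse L)) (List.length-reverse L)
    front : map X (reverse (i ∷ L)) ++ C i ++ concatMap C L ≡ Xs ++ (X i ∷ C i) ++ concatMap C L
    front rewrite List.unfold-reverse i L | List.map-++ X (reverse L) (i ∷ []) =
      List.++-assoc Xs (X i ∷ []) (C i ++ concatMap C L)

  transpose-sign : {g : Form ℕ} → Antisymmetric g → ∀ t n →
    g (downFrom (t * n)) ≈ sign (triangle t * triangle (suc n)) · g (concatMap (λ i → runner t i n) (upTo t))
  transpose-sign anti t zero
    rewrite ℕ.*-zeroʳ t | ℕ.*-zeroʳ (triangle t) | concatMap-[] {A = ℕ} {B = ℕ} (upTo t) = sym (*-identityˡ _)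
  transpose-sign {g} anti t (suc n) = begin
    g (downFrom (t * suc n))
      ≡⟨ cong g (≡.trans (cong downFrom (ℕ.*-suc t n)) (downFrom-+ t (t * n))) ⟩
    g (top ++ downFrom (t * n))
      ≈⟨ transpose-sign (antisymmetric-++ anti top) t n ⟩
    sign (T * triangle (suc n)) · g (top ++ runners n)
      ≈⟨ *-congˡ insert-top ⟩
    sign (T * triangle (suc n)) · (sign (T * suc n) · g (runners (suc n)))
      ≈⟨ trans (*-congʳ (sign-+ (T * triangle (suc n)) _)) (*-assoc _ _ _) ⟨
    sign (T * triangle (suc n) + T * suc n) · g (runners (suc n))
      ≡⟨ cong (λ k → sign k · g (runners (suc n))) triangle-step ⟩
    sign (T * triangle (suc (suc n))) · g (runners (suc n)) ∎
    where
    T = triangle t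
    top = map (t * n +_) (downFrom t)
    runners : ℕ → List ℕ
    runners n = concatMap (λ i → runner t i n) (upTo t)
    insert-top : g (top ++ runners n) ≈ sign (T * suc n) · g (runners (suc n))
    insert-top = begin
      g (top ++ runners n)
        ≡⟨ cong (λ l → g (map (t * n +_) l ++ runners n)) (List.reverse-upTo t) ⟨
      g (map (t * n +_) (reverse (upTo t)) ++ runners n)
        ≈⟨ interleave anti (t * n +_) (λ i → runner t i n) (upTo t)
             (All.tabulate λ _ → List.length-applyDownFrom _ n) ⟩
      sign (triangle (length (upTo t)) * suc n) · g (runners (suc n))
        ≡⟨ cong (λ k → sign (triangle k * suc n) · g (runners (suc n))) (List.length-upTo t) ⟩
      sign (T * suc n) · g (runners (suc n)) ∎
    triangle-step : T * triangle (suc n) + T * suc n ≡ T * triangle (suc (suc n))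
    triangle-step = ≡.trans (ℕ.+-comm (T * triangle (suc n)) _) (≡.sym (ℕ.*-distribˡ-+ T (suc n) _))

module ExteriorProduct {a ℓ} (R : CommutativeRing a ℓ) where
  open CommutativeRing R renaming (_+_ to _⊕_; _*_ to _·_)
  open AlternatingForms R
  open Antisymmetric
  open Alternating
  open BigOperator +-commutativeMonoid
    renaming (fold to ∑; fold-cong to ∑-cong; fold-map to ∑-map; fold-↭ to ∑-↭)
  open BigOperator *-commutativeMonoid using () renaming (fold to ∏)
  open import Algebra.Solver.Ring.NaturalCoefficients.Default commutativeSemiring
    using (solve; _:=_; _:+_; _:*_)
  open import Relation.Binary.Reasoning.Setoid setoid

  private variable
    b e p : Level
    A : Set b
    E E′ : Set e

  ∑-distribˡ : ∀ u (f : A → Carrier) l → u · ∑ f l ≈ ∑ (λ i → u · f i) l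
  ∑-distribˡ u f [] = zeroʳ u
  ∑-distribˡ u f (i ∷ l) = trans (distribˡ u _ _) (+-congˡ (∑-distribˡ u f l))

  -- The product of a 1-form and a form, evaluated on a list of basis vectors.  Read r as a row of a matrix
  -- with columns indexed by E; then this is the Laplace expansion along r.
  infixr 6 _∧_
  _∧_ : (E → Carrier) → Form E → Form E
  (r ∧ g) [] = 0#
  (r ∧ g) (c ∷ cs) = r c · g cs ⊕ -1# · (r ∧ g ∘ (c ∷_)) cs

  ⋀ : List (E → Carrier) → Form E → Form E
  ⋀ rs g = foldr _∧_ g rs

  unit : Form E
  unit [] = 1#
  unit (_ ∷ _) = 0#

  det : List (E → Carrier) → Form E
  det rs = ⋀ rs unit

  ∧-cong : ∀ {P : Pred E p} {r r′ g g′ cs} → All P cs → (∀ c → P c → r c ≈ r′ c) →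
    (∀ l → All P l → suc (length l) ≡ length cs → g l ≈ g′ l) → (r ∧ g) cs ≈ (r′ ∧ g′) cs
  ∧-cong [] r≈ g≈ = refl
  ∧-cong {cs = c ∷ cs} (pc ∷ pcs) r≈ g≈ = +-cong (*-cong (r≈ c pc) (g≈ cs pcs ≡.refl))
    (*-congˡ (∧-cong pcs r≈ (λ l pl eq → g≈ (c ∷ l) (pc ∷ pl) (cong suc eq))))

  ∧-congʳ : ∀ {r : E → Carrier} {g g′} → (∀ l → g l ≈ g′ l) → ∀ cs → (r ∧ g) cs ≈ (r ∧ g′) cs
  ∧-congʳ g≈ cs = ∧-cong (All.universal-U cs) (λ _ _ → refl) (λ l _ _ → g≈ l)

  x≈0∧y≈0⇒x-y≈0 : ∀ {x y} → x ≈ 0# → y ≈ 0# → x ⊕ -1# · y ≈ 0#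
  x≈0∧y≈0⇒x-y≈0 x≈0 y≈0 = trans (+-cong x≈0 (trans (*-congˡ y≈0) (zeroʳ -1#))) (+-identityˡ 0#)

  ∧-zeroˡ : ∀ (g : Form E) cs → ((λ _ → 0#) ∧ g) cs ≈ 0#
  ∧-zeroˡ g [] = refl
  ∧-zeroˡ g (c ∷ cs) = x≈0∧y≈0⇒x-y≈0 (zeroˡ _) (∧-zeroˡ (g ∘ (c ∷_)) cs)

  ∧-zeroʳ : ∀ {r : E → Carrier} {g} → (∀ l → g l ≈ 0#) → ∀ cs → (r ∧ g) cs ≈ 0#
  ∧-zeroʳ g≈0 [] = refl
  ∧-zeroʳ g≈0 (c ∷ cs) = x≈0∧y≈0⇒x-y≈0 (trans (*-congˡ (g≈0 cs)) (zeroʳ _)) (∧-zeroʳ (g≈0 ∘ (c ∷_)) cs)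

  ∧-linearˡ : ∀ u (r s : E → Carrier) g cs → ((λ c → u · r c ⊕ s c) ∧ g) cs ≈ u · (r ∧ g) cs ⊕ (s ∧ g) cs
  ∧-linearˡ u r s g [] = sym (trans (+-identityʳ _) (zeroʳ u))
  ∧-linearˡ u r s g (c ∷ cs) = trans (+-congˡ (*-congˡ (∧-linearˡ u r s (g ∘ (c ∷_)) cs)))
    (solve 7 (λ u r s g m x y → (u :* r :+ s) :* g :+ m :* (u :* x :+ y)
      := u :* (r :* g :+ m :* x) :+ (s :* g :+ m :* y))
      refl u (r c) (s c) (g cs) -1# _ _)

  ∧-linearʳ : ∀ u v (r : E → Carrier) g h cs →
    (r ∧ (λ l → u · g l ⊕ v · h l)) cs ≈ u · (r ∧ g) cs ⊕ v · (r ∧ h) cs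
  ∧-linearʳ u v r g h [] = sym (trans (+-cong (zeroʳ u) (zeroʳ v)) (+-identityˡ 0#))
  ∧-linearʳ u v r g h (c ∷ cs) = trans (+-congˡ (*-congˡ (∧-linearʳ u v r (g ∘ (c ∷_)) (h ∘ (c ∷_)) cs)))
    (solve 8 (λ u v r m g h x y → r :* (u :* g :+ v :* h) :+ m :* (u :* x :+ v :* y)
      := u :* (r :* g :+ m :* x) :+ v :* (r :* h :+ m :* y)) refl u v (r c) -1# _ _ _ _)

  ∧-scaleˡ : ∀ u (r : E → Carrier) g cs → ((λ c → u · r c) ∧ g) cs ≈ u · (r ∧ g) cs
  ∧-scaleˡ u r g [] = sym (zeroʳ u)
  ∧-scaleˡ u r g (c ∷ cs) = trans (+-congˡ (*-congˡ (∧-scaleˡ u r (g ∘ (c ∷_)) cs)))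
    (solve 5 (λ u r g m x → (u :* r) :* g :+ m :* (u :* x) := u :* (r :* g :+ m :* x)) refl u (r c) _ -1# _)

  ∧-scaleʳ : ∀ u (r : E → Carrier) g cs → (r ∧ (λ l → u · g l)) cs ≈ u · (r ∧ g) cs
  ∧-scaleʳ u r g [] = sym (zeroʳ u)
  ∧-scaleʳ u r g (c ∷ cs) = trans (+-congˡ (*-congˡ (∧-scaleʳ u r (g ∘ (c ∷_)) cs)))
    (solve 5 (λ u r g m x → r :* (u :* g) :+ m :* (u :* x) := u :* (r :* g :+ m :* x)) refl u (r c) _ -1# _)

  swap-summands : ∀ x y z → x ⊕ -1# · (y ⊕ -1# · (-1# · z)) ≈ -1# · (y ⊕ -1# · (x ⊕ -1# · z))
  swap-summands x y z = begin
    x ⊕ -1# · (y ⊕ -1# · (-1# · z))                 ≈⟨ +-congʳ (-1·-1·x≈x x) ⟨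
    -1# · (-1# · x) ⊕ -1# · (y ⊕ -1# · (-1# · z))
      ≈⟨ solve 4 (λ m x y z → m :* (m :* x) :+ m :* (y :+ m :* (m :* z)) := m :* (y :+ m :* (x :+ m :* z)))
           refl -1# x y z ⟩
    -1# · (y ⊕ -1# · (x ⊕ -1# · z))                 ∎

  ∧-∷ : ∀ (r s : E → Carrier) g c cs → (r ∧ s ∧ g) (c ∷ cs) ≈
    r c · (s ∧ g) cs ⊕ -1# · (s c · (r ∧ g) cs ⊕ -1# · (r ∧ s ∧ g ∘ (c ∷_)) cs)
  ∧-∷ r s g c cs = +-congˡ (*-congˡ (∧-linearʳ (s c) -1# r g (s ∧ g ∘ (c ∷_)) cs))

  ∧-anticomm : ∀ (r s : E → Carrier) g cs → (r ∧ s ∧ g) cs ≈ -1# · (s ∧ r ∧ g) cs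
  ∧-anticomm r s g [] = sym (zeroʳ -1#)
  ∧-anticomm r s g (c ∷ cs) = begin
    (r ∧ s ∧ g) (c ∷ cs)
      ≈⟨ ∧-∷ r s g c cs ⟩
    r c · (s ∧ g) cs ⊕ -1# · (s c · (r ∧ g) cs ⊕ -1# · (r ∧ s ∧ g ∘ (c ∷_)) cs)
      ≈⟨ +-congˡ (*-congˡ (+-congˡ (*-congˡ (∧-anticomm r s (g ∘ (c ∷_)) cs)))) ⟩
    r c · (s ∧ g) cs ⊕ -1# · (s c · (r ∧ g) cs ⊕ -1# · (-1# · (s ∧ r ∧ g ∘ (c ∷_)) cs))
      ≈⟨ swap-summands _ _ _ ⟩
    -1# · (s c · (r ∧ g) cs ⊕ -1# · (r c · (s ∧ g) cs ⊕ -1# · (s ∧ r ∧ g ∘ (c ∷_)) cs))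
      ≈⟨ *-congˡ (∧-∷ s r g c cs) ⟨
    -1# · (s ∧ r ∧ g) (c ∷ cs) ∎

  ∧-self : ∀ (r : E → Carrier) g cs → (r ∧ r ∧ g) cs ≈ 0#
  ∧-self r g [] = refl
  ∧-self r g (c ∷ cs) = begin
    (r ∧ r ∧ g) (c ∷ cs)                                        ≈⟨ ∧-∷ r r g c cs ⟩
    r c · (r ∧ g) cs ⊕ -1# · (r c · (r ∧ g) cs ⊕ -1# · (r ∧ r ∧ g ∘ (c ∷_)) cs)
      ≈⟨ +-congˡ (*-congˡ (+-congˡ (trans (*-congˡ (∧-self r (g ∘ (c ∷_)) cs)) (zeroʳ -1#)))) ⟩
    r c · (r ∧ g) cs ⊕ -1# · (r c · (r ∧ g) cs ⊕ 0#)            ≈⟨ +-congˡ (*-congˡ (+-identityʳ _)) ⟩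
    r c · (r ∧ g) cs ⊕ -1# · (r c · (r ∧ g) cs)                 ≈⟨ x-x≈0 _ ⟩
    0#                                                          ∎

  ⋀-++ : ∀ (rs ss : List (E → Carrier)) g cs → ⋀ (rs ++ ss) g cs ≡ ⋀ rs (⋀ ss g) cs
  ⋀-++ rs ss g cs = cong (λ h → h cs) (List.foldr-++ _∧_ g rs ss)

  rows-alternating : ∀ (g : Form E) cs → Alternating (λ rs → ⋀ rs g cs)
  rows-alternating g cs = record
    { antisymmetric = record { swapped = swap-rows cs }
    ; repeated = repeat-row cs
    }
    where
    swap-rows : ∀ cs p u v q → ⋀ (p ++ u ∷ v ∷ q) g cs ≈ -1# · ⋀ (p ++ v ∷ u ∷ q) g cs
    swap-rows cs [] u v q = ∧-anticomm u v (⋀ q g) cs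
    swap-rows cs (r ∷ p) u v q = trans (∧-congʳ (λ l → swap-rows l p u v q) cs) (∧-scaleʳ -1# r _ cs)
    repeat-row : ∀ cs p u q → ⋀ (p ++ u ∷ u ∷ q) g cs ≈ 0#
    repeat-row cs [] u q = ∧-self u (⋀ q g) cs
    repeat-row cs (r ∷ p) u q = ∧-zeroʳ (λ l → repeat-row l p u q) cs

  ∧-antisymmetric : ∀ {r : E → Carrier} {g} → Antisymmetric g → Antisymmetric (r ∧ g)
  ∧-antisymmetric {r = r} {g} anti .swapped [] u v q = begin
    r u · g (v ∷ q) ⊕ -1# · (r v · g (u ∷ q) ⊕ -1# · (r ∧ (λ l → g (u ∷ v ∷ l))) q)
      ≈⟨ +-congˡ (*-congˡ (+-congˡ (*-congˡ (trans (∧-congʳ (swapped anti [] u v) q) (∧-scaleʳ -1# r _ q))))) ⟩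
    r u · g (v ∷ q) ⊕ -1# · (r v · g (u ∷ q) ⊕ -1# · (-1# · (r ∧ (λ l → g (v ∷ u ∷ l))) q))
      ≈⟨ swap-summands _ _ _ ⟩
    -1# · (r v · g (u ∷ q) ⊕ -1# · (r u · g (v ∷ q) ⊕ -1# · (r ∧ (λ l → g (v ∷ u ∷ l))) q)) ∎
  ∧-antisymmetric {r = r} {g} anti .swapped (c ∷ p) u v q = trans
    (+-cong (*-congˡ (swapped anti p u v q))
      (*-congˡ (swapped (∧-antisymmetric (antisymmetric-∷ anti c)) p u v q)))
    (solve 4 (λ m r g x → r :* (m :* g) :+ m :* (m :* x) := m :* (r :* g :+ m :* x)) refl -1# (r c) _ _)

  columns-antisymmetric : ∀ (rs : List (E → Carrier)) → Antisymmetric (det rs)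
  columns-antisymmetric [] .swapped [] u v q = sym (zeroʳ -1#)
  columns-antisymmetric [] .swapped (_ ∷ _) u v q = sym (zeroʳ -1#)
  columns-antisymmetric (r ∷ rs) = ∧-antisymmetric (columns-antisymmetric rs)

  ⋀-cong : ∀ {P : Pred E p} {rs rs′ g g′} → Pointwise (λ r r′ → ∀ c → P c → r c ≈ r′ c) rs rs′ →
    (∀ l → All P l → g l ≈ g′ l) → ∀ {cs} → All P cs → ⋀ rs g cs ≈ ⋀ rs′ g′ cs
  ⋀-cong [] g≈ {cs} pcs = g≈ cs pcs
  ⋀-cong (r≈ ∷ rs≈) g≈ pcs = ∧-cong pcs r≈ (λ l pl _ → ⋀-cong rs≈ g≈ pl)

  ⋀-map-cong : ∀ {r r′ : A → E → Carrier} → (∀ i c → r i c ≈ r′ i c) → ∀ L g cs →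
    ⋀ (map r L) g cs ≈ ⋀ (map r′ L) g cs
  ⋀-map-cong r≈ L g cs = ⋀-cong (Pointwise.map⁺ _ _ (Pointwise.refl (λ {i} c _ → r≈ i c) {x = L}))
    (λ _ _ → refl) (All.universal-U cs)

  ⋀-scale : ∀ (u : A → Carrier) (r : A → E → Carrier) g L cs →
    ⋀ (map (λ i c → u i · r i c) L) g cs ≈ ∏ u L · ⋀ (map r L) g cs
  ⋀-scale u r g [] cs = sym (*-identityˡ _)
  ⋀-scale u r g (i ∷ L) cs = begin
    ((λ c → u i · r i c) ∧ ⋀ (map (λ i c → u i · r i c) L) g) cs  ≈⟨ ∧-scaleˡ (u i) (r i) _ cs ⟩
    u i · (r i ∧ ⋀ (map (λ i c → u i · r i c) L) g) cs            ≈⟨ *-congˡ (∧-congʳ (⋀-scale u r g L) cs) ⟩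
    u i · (r i ∧ (λ l → ∏ u L · ⋀ (map r L) g l)) cs              ≈⟨ *-congˡ (∧-scaleʳ (∏ u L) (r i) _ cs) ⟩
    u i · (∏ u L · (r i ∧ ⋀ (map r L) g) cs)                      ≈⟨ *-assoc _ _ _ ⟨
    (u i · ∏ u L) · (r i ∧ ⋀ (map r L) g) cs                      ∎

  ∧-map : ∀ (h : E → E′) r {g g′} → (∀ l → g l ≈ g′ (map h l)) → ∀ cs → (r ∘ h ∧ g) cs ≈ (r ∧ g′) (map h cs)
  ∧-map h r g≈ [] = refl
  ∧-map h r g≈ (c ∷ cs) = +-cong (*-congˡ (g≈ cs)) (*-congˡ (∧-map h r (g≈ ∘ (c ∷_)) cs))

  det-map : ∀ (h : E → E′) (r : A → E′ → Carrier) L cs →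
    det (map (λ i → r i ∘ h) L) cs ≈ det (map r L) (map h cs)
  det-map h r [] [] = refl
  det-map h r [] (_ ∷ _) = refl
  det-map h r (i ∷ L) cs = ∧-map h (r i) (det-map h r L) cs

  -- The determinant of a product

  picks : List A → List (A × List A)
  picks [] = []
  picks (i ∷ J) = (i , J) ∷ map (λ (j , K) → j , i ∷ K) (picks J)

  picks-↭ : ∀ (J : List A) → All (λ (i , K) → J ↭ i ∷ K) (picks J)
  picks-↭ [] = []
  picks-↭ (i ∷ J) = ↭-refl ∷ All.map⁺ (All.map (λ J↭ → ↭-trans (prep i J↭) (swap _ _ ↭-refl)) (picks-↭ J))

  map-proj₁-picks : ∀ (J : List A) → map proj₁ (picks J) ≡ J
  map-proj₁-picks [] = ≡.refl
  map-proj₁-picks (i ∷ J) = cong (i ∷_) (≡.trans (≡.sym (List.map-∘ (picks J))) (map-proj₁-picks J))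

  ∑-picks : ∀ (f : A → Carrier) J → ∑ f J ≈ ∑ (f ∘ proj₁) (picks J)
  ∑-picks f J = trans (reflexive (cong (∑ f) (≡.sym (map-proj₁-picks J)))) (reflexive (∑-map f proj₁ (picks J)))

  ∧-as-∑ : ∀ (w : A → Carrier) h {Ψ} → Antisymmetric Ψ → ∀ J →
    ∑ (λ (i , K) → w i · (h K · Ψ (i ∷ K))) (picks J) ≈ (w ∧ h) J · Ψ J
  ∧-as-∑ w h anti [] = sym (zeroˡ _)
  ∧-as-∑ w h {Ψ} anti (i ∷ J) = begin
    w i · (h J · Ψ (i ∷ J)) ⊕ ∑ (λ (j , K) → w j · (h K · Ψ (j ∷ K))) (map (λ (j , K) → j , i ∷ K) (picks J))
      ≡⟨ cong (w i · (h J · Ψ (i ∷ J)) ⊕_) (∑-map (λ (j , K) → w j · (h K · Ψ (j ∷ K))) _ (picks J)) ⟩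
    w i · (h J · Ψ (i ∷ J)) ⊕ ∑ (λ (j , K) → w j · (h (i ∷ K) · Ψ (j ∷ i ∷ K))) (picks J)
      ≈⟨ +-congˡ (∑-cong {l = picks J} (All.tabulate λ { {j , K} _ → swapped-term j K })) ⟩
    w i · (h J · Ψ (i ∷ J)) ⊕ ∑ (λ (j , K) → -1# · (w j · (h (i ∷ K) · Ψ (i ∷ j ∷ K)))) (picks J)
      ≈⟨ +-congˡ (∑-distribˡ -1# _ (picks J)) ⟨
    w i · (h J · Ψ (i ∷ J)) ⊕ -1# · ∑ (λ (j , K) → w j · (h (i ∷ K) · Ψ (i ∷ j ∷ K))) (picks J)
      ≈⟨ +-congˡ (*-congˡ (∧-as-∑ w (h ∘ (i ∷_)) (antisymmetric-∷ anti i) J)) ⟩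
    w i · (h J · Ψ (i ∷ J)) ⊕ -1# · ((w ∧ h ∘ (i ∷_)) J · Ψ (i ∷ J))
      ≈⟨ solve 5 (λ w h p m x → w :* (h :* p) :+ m :* (x :* p) := (w :* h :+ m :* x) :* p) refl _ _ _ -1# _ ⟩
    (w ∧ h) (i ∷ J) · Ψ (i ∷ J) ∎
    where
    swapped-term : ∀ j K → w j · (h (i ∷ K) · Ψ (j ∷ i ∷ K)) ≈ -1# · (w j · (h (i ∷ K) · Ψ (i ∷ j ∷ K)))
    swapped-term j K = trans (*-congˡ (*-congˡ (swapped anti [] j i K)))
      (solve 4 (λ w h m p → w :* (h :* (m :* p)) := m :* (w :* (h :* p))) refl (w j) _ -1# _)

  ∧-reduce-rows : ∀ (n : E → Carrier) (u : A → Carrier) (r : A → E → Carrier) g ws cs →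
    (n ∧ ⋀ (map (λ w c → u w · n c ⊕ r w c) ws) g) cs ≈ (n ∧ ⋀ (map r ws) g) cs
  ∧-reduce-rows n u r g [] cs = refl
  ∧-reduce-rows n u r g (w ∷ ws) cs = begin
    (n ∧ (λ c → u w · n c ⊕ r w c) ∧ G) cs            ≈⟨ ∧-anticomm n _ G cs ⟩
    -1# · ((λ c → u w · n c ⊕ r w c) ∧ n ∧ G) cs      ≈⟨ *-congˡ (∧-linearˡ (u w) n (r w) (n ∧ G) cs) ⟩
    -1# · (u w · (n ∧ n ∧ G) cs ⊕ (r w ∧ n ∧ G) cs)
      ≈⟨ *-congˡ (trans (+-congʳ (trans (*-congˡ (∧-self n G cs)) (zeroʳ (u w)))) (+-identityˡ _)) ⟩
    -1# · (r w ∧ n ∧ G) cs                            ≈⟨ *-congˡ (∧-congʳ (∧-reduce-rows n u r g ws) cs) ⟩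
    -1# · (r w ∧ n ∧ ⋀ (map r ws) g) cs               ≈⟨ ∧-anticomm n (r w) (⋀ (map r ws) g) cs ⟨
    (n ∧ r w ∧ ⋀ (map r ws) g) cs                     ∎
    where
    G = ⋀ (map (λ w c → u w · n c ⊕ r w c) ws) g

  combine : List A → (A → E → Carrier) → (A → Carrier) → E → Carrier
  combine J N w c = ∑ (λ i → w i · N i c) J

  ∧-combine : ∀ (J : List A) (N : A → E → Carrier) w g cs →
    (combine J N w ∧ g) cs ≈ ∑ (λ i → w i · (N i ∧ g) cs) J
  ∧-combine [] N w g cs = ∧-zeroˡ g cs
  ∧-combine (i ∷ J) N w g cs =
    trans (∧-linearˡ (w i) (N i) (combine J N w) g cs) (+-congˡ (∧-combine J N w g cs))

  -- In the expansion of the first row the term of N i reduces the index set of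
  -- the other rows to the rest K of J, because N i ∧ N i = 0.
  ⋀-combine : ∀ (J : List A) (N : A → E → Carrier) ws g cs → length J ≡ length ws →
    ⋀ (map (combine J N) ws) g cs ≈ det ws J · ⋀ (map N J) g cs
  ⋀-combine [] N [] g cs _ = sym (*-identityˡ _)
  ⋀-combine J N (w ∷ ws) g cs |J|≡ = begin
    (combine J N w ∧ G) cs
      ≈⟨ ∧-combine J N w G cs ⟩
    ∑ (λ i → w i · (N i ∧ G) cs) J
      ≈⟨ ∑-picks _ J ⟩
    ∑ (λ (i , _) → w i · (N i ∧ G) cs) (picks J)
      ≈⟨ ∑-cong (All.map (λ J↭i∷K → *-congˡ (term J↭i∷K)) (picks-↭ J)) ⟩
    ∑ (λ (i , K) → w i · (det ws K · ⋀ (map N (i ∷ K)) g cs)) (picks J)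
      ≈⟨ ∧-as-∑ w (det ws) (antisymmetric-map (antisymmetric (rows-alternating g cs)) N) J ⟩
    (w ∧ det ws) J · ⋀ (map N J) g cs ∎
    where
    G = ⋀ (map (combine J N) ws) g
    term : ∀ {i K} → J ↭ i ∷ K → (N i ∧ G) cs ≈ det ws K · ⋀ (map N (i ∷ K)) g cs
    term {i} {K} J↭i∷K = begin
      (N i ∧ G) cs
        ≈⟨ ∧-congʳ (⋀-map-cong (λ w′ c → ∑-↭ (λ i → w′ i · N i c) J↭i∷K) ws g) cs ⟩
      (N i ∧ ⋀ (map (λ w′ c → w′ i · N i c ⊕ combine K N w′ c) ws) g) cs
        ≈⟨ ∧-reduce-rows (N i) (λ w′ → w′ i) (combine K N) g ws cs ⟩
      (N i ∧ ⋀ (map (combine K N) ws) g) cs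
        ≈⟨ ∧-congʳ (λ l → ⋀-combine K N ws g l
             (ℕ.suc-injective (≡.trans (≡.sym (Perm.↭-length J↭i∷K)) |J|≡))) cs ⟩
      (N i ∧ (λ l → det ws K · ⋀ (map N K) g l)) cs
        ≈⟨ ∧-scaleʳ (det ws K) (N i) (⋀ (map N K) g) cs ⟩
      det ws K · ⋀ (map N (i ∷ K)) g cs ∎

  ∧-++ : ∀ {r : E → Carrier} {g} cs ds → (∀ l → g (cs ++ l) ≈ 0#) →
    (r ∧ g) (cs ++ ds) ≈ (r ∧ (λ l → g (l ++ ds))) cs
  ∧-++ [] ds g≈0 = ∧-zeroʳ g≈0 ds
  ∧-++ (c ∷ cs) ds g≈0 = +-congˡ (*-congˡ (∧-++ cs ds g≈0))

  -- Vanishing by counting columns, and block triangular determinants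

  VanishesFrom : {P : Pred E p} → Decidable P → ℕ → Form E → Set _
  VanishesFrom P? k g = ∀ l → k ≤ count P? l → g l ≈ 0#

  ZeroOn : Pred E p → (E → Carrier) → Set _
  ZeroOn P r = ∀ c → P c → r c ≈ 0#

  module _ {P : Pred E p} (P? : Decidable P) where

    vanishes-∷-accept : ∀ {k g c} → P c → VanishesFrom P? k g → VanishesFrom P? (ℕ.pred k) (g ∘ (c ∷_))
    vanishes-∷-accept {zero} pc g≈0 l _ = g≈0 (_ ∷ l) z≤n
    vanishes-∷-accept {suc k} pc g≈0 l k≤ =
      g≈0 (_ ∷ l) (subst (suc k ≤_) (cong length (≡.sym (List.filter-accept P? pc))) (s≤s k≤))

    vanishes-∷-reject : ∀ {k g c} → ¬ P c → VanishesFrom P? k g → VanishesFrom P? k (g ∘ (c ∷_))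
    vanishes-∷-reject {k} ¬pc g≈0 l k≤ =
      g≈0 (_ ∷ l) (subst (k ≤_) (cong length (≡.sym (List.filter-reject P? ¬pc))) k≤)

    unit-vanishes : VanishesFrom P? 1 unit
    unit-vanishes (_ ∷ _) _ = refl

    ∧-vanishes : ∀ {r k g} → VanishesFrom P? k g → VanishesFrom P? (suc k) (r ∧ g)
    ∧-vanishes g≈0 [] _ = refl
    ∧-vanishes {k = zero} g≈0 cs@(_ ∷ _) _ = ∧-zeroʳ (λ l → g≈0 l z≤n) cs
    ∧-vanishes {k = suc k} g≈0 (c ∷ cs) k≤ with P? c
    ... | yes pc = x≈0∧y≈0⇒x-y≈0 (trans (*-congˡ (g≈0 cs (ℕ.≤-pred k≤))) (zeroʳ _))
                     (∧-vanishes (vanishes-∷-accept pc g≈0) cs (ℕ.≤-pred k≤))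
    ... | no ¬pc = x≈0∧y≈0⇒x-y≈0 (trans (*-congˡ (g≈0 cs (ℕ.<⇒≤ k≤))) (zeroʳ _))
                     (∧-vanishes (vanishes-∷-reject ¬pc g≈0) cs k≤)

    ∧-vanishes-ZeroOn : ∀ {r k g} → ZeroOn P r → VanishesFrom P? k g → VanishesFrom P? k (r ∧ g)
    ∧-vanishes-ZeroOn r≈0 g≈0 [] _ = refl
    ∧-vanishes-ZeroOn r≈0 g≈0 (c ∷ cs) k≤ with P? c
    ... | yes pc = x≈0∧y≈0⇒x-y≈0 (trans (*-congʳ (r≈0 c pc)) (zeroˡ _))
                     (∧-vanishes-ZeroOn r≈0 (vanishes-∷-accept pc g≈0) cs (ℕ.pred-mono-≤ k≤))
    ... | no ¬pc = x≈0∧y≈0⇒x-y≈0 (trans (*-congˡ (g≈0 cs k≤)) (zeroʳ _))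
                     (∧-vanishes-ZeroOn r≈0 (vanishes-∷-reject ¬pc g≈0) cs k≤)

    ⋀-vanishes : ∀ rs {k g} → VanishesFrom P? k g → VanishesFrom P? (length rs + k) (⋀ rs g)
    ⋀-vanishes [] g≈0 = g≈0
    ⋀-vanishes (r ∷ rs) g≈0 = ∧-vanishes (⋀-vanishes rs g≈0)

    ⋀-vanishes-ZeroOn : ∀ {rs k g} → All (ZeroOn P) rs → VanishesFrom P? k g → VanishesFrom P? k (⋀ rs g)
    ⋀-vanishes-ZeroOn [] g≈0 = g≈0
    ⋀-vanishes-ZeroOn (r≈0 ∷ rs≈0) g≈0 = ∧-vanishes-ZeroOn r≈0 (⋀-vanishes-ZeroOn rs≈0 g≈0)

    length≤count : ∀ {cs} → All P cs → ∀ ds → length cs ≤ count P? (cs ++ ds)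
    length≤count {cs} pcs ds = subst (length cs ≤_) (cong length (≡.sym (List.filter-++ P? cs ds)))
      (subst (λ l → length cs ≤ length (l ++ filter P? ds)) (≡.sym (List.filter-all P? pcs))
        (List.length-++-≤ˡ cs))

    ⋀-block : ∀ rs {g} → VanishesFrom P? 1 g → ∀ cs ds → All P cs → length cs ≡ length rs →
      ⋀ rs g (cs ++ ds) ≈ g ds · det rs cs
    ⋀-block [] g≈0 [] ds _ _ = sym (*-identityʳ _)
    ⋀-block (r ∷ rs) {g} g≈0 cs ds pcs |cs|≡ = begin
      (r ∧ ⋀ rs g) (cs ++ ds)            ≈⟨ ∧-++ cs ds too-many ⟩
      (r ∧ (λ l → ⋀ rs g (l ++ ds))) cs  ≈⟨ ∧-cong pcs (λ _ _ → refl) block ⟩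
      (r ∧ (λ l → g ds · det rs l)) cs   ≈⟨ ∧-scaleʳ (g ds) r (det rs) cs ⟩
      g ds · det (r ∷ rs) cs             ∎
      where
      too-many : ∀ l → ⋀ rs g (cs ++ l) ≈ 0#
      too-many l = ⋀-vanishes rs g≈0 (cs ++ l)
        (subst (_≤ count P? (cs ++ l)) (≡.trans |cs|≡ (ℕ.+-comm 1 (length rs))) (length≤count pcs l))
      block : ∀ l → All P l → suc (length l) ≡ length cs → ⋀ rs g (l ++ ds) ≈ g ds · det rs l
      block l pl |l|≡ = ⋀-block rs g≈0 l ds pl (ℕ.suc-injective (≡.trans |l|≡ |cs|≡))

    det-block : ∀ rs {ss} → All (ZeroOn P) ss → ∀ cs ds → All P cs → length cs ≡ length rs →
      det (rs ++ ss) (cs ++ ds) ≈ det rs cs · det ss ds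
    det-block rs {ss} ss≈0 cs ds pcs |cs|≡ = begin
      det (rs ++ ss) (cs ++ ds)    ≡⟨ ⋀-++ rs ss unit (cs ++ ds) ⟩
      ⋀ rs (det ss) (cs ++ ds)     ≈⟨ ⋀-block rs (⋀-vanishes-ZeroOn ss≈0 unit-vanishes) cs ds pcs |cs|≡ ⟩
      det ss ds · det rs cs        ≈⟨ *-comm _ _ ⟩
      det rs cs · det ss ds        ∎

  det-block-triangular : {P : A → Pred E p} (P? : ∀ i → Decidable (P i))
    (R : A → List (E → Carrier)) (C : A → List E) → ∀ {L} →
    AllPairs (λ i j → All (ZeroOn (P i)) (R j)) L →
    All (λ i → All (P i) (C i) × length (C i) ≡ length (R i)) L →
    det (concatMap R L) (concatMap C L) ≈ ∏ (λ i → det (R i) (C i)) L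
  det-block-triangular P? R C [] [] = refl
  det-block-triangular P? R C {i ∷ L} (R≈0 ∷ rest≈0) ((pC , |C|≡) ∷ rest) = trans
    (det-block (P? i) (R i) (All.concat⁺ (All.map⁺ R≈0)) (C i) (concatMap C L) pC |C|≡)
    (*-congˡ (det-block-triangular P? R C rest≈0 rest))

module Vandermonde {a ℓ} (F : Field a ℓ) where
  open FieldOps F hiding (det)
  open AlternatingForms commutativeRing
  open ExteriorProduct commutativeRing
  open BigOperator *-commutativeMonoid using () renaming (fold to ∏)
  open import Algebra.Properties.CommutativeSemiring.Exp commutativeSemiring as Exp using ()
  open import Algebra.Solver.Ring.NaturalCoefficients.Default commutativeSemiring
    using (solve; _:=_; _:+_; _:*_)
  open import Relation.Binary.Reasoning.Setoid setoid

  private variable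
    e : Level
    E : Set e

  ^≡ : ∀ x n → x ^ n ≡ x Exp.^ n
  ^≡ x zero = ≡.refl
  ^≡ x (suc n) = cong (x ·_) (^≡ x n)

  sgnPow≡sign : ∀ k → sgnPow k ≡ sign k
  sgnPow≡sign = ^≡ -1#

  ^-homo-* : ∀ x m n → x ^ (m + n) ≈ x ^ m · x ^ n
  ^-homo-* x m n rewrite ^≡ x (m + n) | ^≡ x m | ^≡ x n = Exp.^-homo-* x m n

  ^-assocʳ : ∀ x m n → (x ^ m) ^ n ≈ x ^ (m * n)
  ^-assocʳ x m n rewrite ^≡ (x ^ m) n | ^≡ x m | ^≡ x (m * n) = Exp.^-assocʳ x m n

  ^-distrib-* : ∀ x y n → (x · y) ^ n ≈ x ^ n · y ^ n
  ^-distrib-* x y n rewrite ^≡ (x · y) n | ^≡ x n | ^≡ y n = Exp.^-distrib-* x y n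

  ^-congˡ : ∀ n {x y} → x ≈ y → x ^ n ≈ y ^ n
  ^-congˡ n {x} {y} x≈y rewrite ^≡ x n | ^≡ y n = Exp.^-congˡ n x≈y

  ∏-const : ∀ v (l : List E) → ∏ (λ _ → v) l ≈ v ^ length l
  ∏-const v [] = refl
  ∏-const v (_ ∷ l) = *-congˡ (∏-const v l)

  1^n≈1 : ∀ n → 1# ^ n ≈ 1#
  1^n≈1 zero = refl
  1^n≈1 (suc n) = trans (*-identityˡ _) (1^n≈1 n)

  x-y≈0⇒x≈y : ∀ {x y} → x ⊕ -1# · y ≈ 0# → x ≈ y
  x-y≈0⇒x≈y {x} {y} x-y≈0 = begin
    x                    ≈⟨ +-identityʳ x ⟨
    x ⊕ 0#               ≈⟨ +-congˡ (x-x≈0 y) ⟨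
    x ⊕ (y ⊕ -1# · y)    ≈⟨ solve 3 (λ x y z → x :+ (y :+ z) := (x :+ z) :+ y) refl x y _ ⟩
    (x ⊕ -1# · y) ⊕ y    ≈⟨ +-congʳ x-y≈0 ⟩
    0# ⊕ y               ≈⟨ +-identityˡ y ⟩
    y                    ∎

  ·-cancelˡ : ∀ {x y z} → x ≉ 0# → x · y ≈ x · z → y ≈ z
  ·-cancelˡ {x} {y} {z} x≉0 xy≈xz = begin
    y               ≈⟨ cancel y ⟨
    x ⁻¹ · (x · y)  ≈⟨ *-congˡ xy≈xz ⟩
    x ⁻¹ · (x · z)  ≈⟨ cancel z ⟩
    z               ∎
    where
    cancel : ∀ y → x ⁻¹ · (x · y) ≈ y
    cancel y = begin
      x ⁻¹ · (x · y)   ≈⟨ solve 3 (λ x i y → i :* (x :* y) := (x :* i) :* y) refl x (x ⁻¹) y ⟩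
      (x · x ⁻¹) · y   ≈⟨ *-congʳ (⁻¹-inverse x x≉0) ⟩
      1# · y           ≈⟨ *-identityˡ y ⟩
      y                ∎

  x·y≈0⇒y≈0 : ∀ {x y} → x ≉ 0# → x · y ≈ 0# → y ≈ 0#
  x·y≈0⇒y≈0 x≉0 xy≈0 = ·-cancelˡ x≉0 (trans xy≈0 (sym (zeroʳ _)))

  -- Comparison with the determinant of a list of rows

  matrix : List (E → Carrier) → List E → List (List Carrier)
  matrix rs cs = map (λ r → map r cs) rs

  dropAt-map-++ : ∀ (r : E → Carrier) p c q → dropAt (length p) (map r (p ++ c ∷ q)) ≡ map r (p ++ q)
  dropAt-map-++ r [] c q = ≡.refl
  dropAt-map-++ r (x ∷ p) c q = cong (r x ∷_) (dropAt-map-++ r p c q)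

  detN-matrix : ∀ (rs : List (E → Carrier)) cs → length cs ≡ length rs →
    detN (length rs) (matrix rs cs) ≈ det rs cs

  expand-matrix : ∀ (r : E → Carrier) rs p q → length (p ++ q) ≡ suc (length rs) →
    expand (length rs) (length p) (map r q) (matrix rs (p ++ q)) ≈ sgnPow (length p) · (r ∧ det rs ∘ (p ++_)) q

  detN-matrix [] [] _ = refl
  detN-matrix (r ∷ rs) cs |cs|≡ = trans (expand-matrix r rs [] cs |cs|≡) (*-identityˡ _)

  expand-matrix r rs p [] _ = sym (zeroʳ _)
  expand-matrix r rs p (c ∷ q) |p++c∷q|≡ = begin
    (s · r c) · detN n (map (dropAt (length p)) (matrix rs (p ++ c ∷ q)))
      ⊕ expand n (suc (length p)) (map r q) (matrix rs (p ++ c ∷ q))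
      ≡⟨ cong₂ _⊕_ (cong (λ M → (s · r c) · detN n M) minor)
           (cong₂ (λ k l → expand n k (map r q) (matrix rs l)) |p∷ʳc|≡ (List.++-assoc p (c ∷ []) q)) ⟨
    (s · r c) · detN n (matrix rs (p ++ q)) ⊕ expand n (length p∷ʳc) (map r q) (matrix rs (p∷ʳc ++ q))
      ≈⟨ +-cong (*-congˡ (detN-matrix rs (p ++ q) |p++q|≡))
           (expand-matrix r rs p∷ʳc q (≡.trans (cong length (List.++-assoc p (c ∷ []) q)) |p++c∷q|≡)) ⟩
    (s · r c) · det rs (p ++ q) ⊕ sgnPow (length p∷ʳc) · (r ∧ det rs ∘ (p∷ʳc ++_)) q
      ≈⟨ +-congˡ (*-cong (reflexive (cong sgnPow |p∷ʳc|≡))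
           (∧-congʳ (λ l → reflexive (cong (det rs) (List.++-assoc p (c ∷ []) l))) q)) ⟩
    (s · r c) · det rs (p ++ q) ⊕ (-1# · s) · (r ∧ (λ l → det rs (p ++ c ∷ l))) q
      ≈⟨ solve 5 (λ s r d m x → (s :* r) :* d :+ (m :* s) :* x := s :* (r :* d :+ m :* x))
           refl s (r c) _ -1# _ ⟩
    s · (r ∧ det rs ∘ (p ++_)) (c ∷ q) ∎
    where
    n = length rs
    s = sgnPow (length p)
    p∷ʳc = p ++ c ∷ []
    minor : matrix rs (p ++ q) ≡ map (dropAt (length p)) (matrix rs (p ++ c ∷ q))
    minor = ≡.trans (List.map-cong (λ r → ≡.sym (dropAt-map-++ r p c q)) rs) (List.map-∘ rs)
    |p∷ʳc|≡ : length p∷ʳc ≡ suc (length p)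
    |p∷ʳc|≡ = ≡.trans (List.length-++ p) (ℕ.+-comm (length p) 1)
    |p++q|≡ : length (p ++ q) ≡ n
    |p++q|≡ = ℕ.suc-injective (≡.trans (≡.sym (List.length-++-sucʳ p c q)) |p++c∷q|≡)

  pow : Carrier → ℕ → Carrier
  pow y e = y ^ e

  vandermonde : List Carrier → List ℕ → Carrier
  vandermonde ys = det (map pow ys)

  vandermonde-cong : ∀ {ys zs} → Pointwise _≈_ ys zs → ∀ es → vandermonde ys es ≈ vandermonde zs es
  vandermonde-cong ys≈zs es = ⋀-cong (Pointwise.map⁺ pow pow (Pointwise.map (λ y≈z e _ → ^-congˡ e y≈z) ys≈zs))
    (λ _ _ → refl) (All.universal-U es)

  alternant≈vandermonde : ∀ ys μ {N es} → length ys ≡ N → exponents N μ ≡ es →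
    alternant ys μ ≈ vandermonde ys es
  alternant≈vandermonde ys μ {N} ≡.refl ≡.refl = trans
    (reflexive (cong₂ detN (≡.trans (List.length-map _ ys) (≡.sym (List.length-map pow ys))) (List.map-∘ ys)))
    (detN-matrix (map pow ys) (exponents N μ) (≡.trans (length-exponents N μ) (≡.sym (List.length-map pow ys))))

  -- Polynomials; coefficients are listed from the leading one downwards.
  poly : List Carrier → Carrier → Carrier
  poly [] y = 0#
  poly (k ∷ ks) y = k · y ^ length ks ⊕ poly ks y

  poly-scale : ∀ u ks y → poly (map (u ·_) ks) y ≈ u · poly ks y
  poly-scale u [] y = sym (zeroʳ u)
  poly-scale u (k ∷ ks) y = begin
    (u · k) · y ^ length (map (u ·_) ks) ⊕ poly (map (u ·_) ks) y
      ≈⟨ +-cong (*-congˡ (reflexive (cong (y ^_) (List.length-map (u ·_) ks)))) (poly-scale u ks y) ⟩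
    (u · k) · y ^ length ks ⊕ u · poly ks y
      ≈⟨ solve 4 (λ u k Y p → (u :* k) :* Y :+ u :* p := u :* (k :* Y :+ p)) refl u k _ _ ⟩
    u · poly (k ∷ ks) y ∎

  -- The quotient of poly (k ∷ ks) by y - r, from synthetic division; the remainder is poly (k ∷ ks) r.
  divide : Carrier → Carrier → List Carrier → List Carrier
  divide r k [] = []
  divide r k (l ∷ ks) = k ∷ divide r (l ⊕ r · k) ks

  length-divide : ∀ r k ks → length (divide r k ks) ≡ length ks
  length-divide r k [] = ≡.refl
  length-divide r k (l ∷ ks) = cong suc (length-divide r _ ks)

  poly-divide : ∀ r k ks y → poly (k ∷ ks) y ≈ (y ⊕ -1# · r) · poly (divide r k ks) y ⊕ poly (k ∷ ks) r
  poly-divide r k [] y = sym (trans (+-congʳ (zeroʳ _)) (+-identityˡ _))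
  poly-divide r k (l ∷ ks) y = begin
    k · (y · Y) ⊕ (l · Y ⊕ P)
      ≈⟨ trans (+-congˡ (x-x≈0 ((r · k) · Y))) (+-identityʳ _) ⟨
    (k · (y · Y) ⊕ (l · Y ⊕ P)) ⊕ ((r · k) · Y ⊕ -1# · ((r · k) · Y))
      ≈⟨ solve 7 (λ k y Y l P r m → (k :* (y :* Y) :+ (l :* Y :+ P)) :+ ((r :* k) :* Y :+ m :* ((r :* k) :* Y))
           := (y :+ m :* r) :* (k :* Y) :+ ((l :+ r :* k) :* Y :+ P)) refl k y Y l P r -1# ⟩
    (y ⊕ -1# · r) · (k · Y) ⊕ poly (l ⊕ r · k ∷ ks) y
      ≈⟨ +-congˡ (poly-divide r (l ⊕ r · k) ks y) ⟩
    (y ⊕ -1# · r) · (k · Y) ⊕ ((y ⊕ -1# · r) · Q ⊕ poly (l ⊕ r · k ∷ ks) r)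
      ≈⟨ solve 8 (λ d kY q l r k R P → d :* kY :+ (d :* q :+ ((l :+ r :* k) :* R :+ P))
           := d :* (kY :+ q) :+ (k :* (r :* R) :+ (l :* R :+ P)))
           refl (y ⊕ -1# · r) (k · Y) Q l r k (r ^ length ks) (poly ks r) ⟩
    (y ⊕ -1# · r) · (k · Y ⊕ Q) ⊕ poly (k ∷ l ∷ ks) r
      ≡⟨ cong (λ n → (y ⊕ -1# · r) · (k · y ^ n ⊕ Q) ⊕ poly (k ∷ l ∷ ks) r) (length-divide r _ ks) ⟨
    (y ⊕ -1# · r) · (k · y ^ length (divide r (l ⊕ r · k) ks) ⊕ Q) ⊕ poly (k ∷ l ∷ ks) r ∎
    where
    Y = y ^ length ks
    P = poly ks y
    Q = poly (divide r (l ⊕ r · k) ks) y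

  root-divide : ∀ {r k ks y} → poly (k ∷ ks) r ≈ 0# → y ≉ r → poly (k ∷ ks) y ≈ 0# → poly (divide r k ks) y ≈ 0#
  root-divide {r} {k} {ks} {y} root y≉r root′ = x·y≈0⇒y≈0 (y≉r ∘ x-y≈0⇒x≈y) (begin
    (y ⊕ -1# · r) · poly (divide r k ks) y                    ≈⟨ trans (+-congˡ root) (+-identityʳ _) ⟨
    (y ⊕ -1# · r) · poly (divide r k ks) y ⊕ poly (k ∷ ks) r  ≈⟨ poly-divide r k ks y ⟨
    poly (k ∷ ks) y                                           ≈⟨ root′ ⟩
    0#                                                        ∎)

  roots≤degree : ∀ {k} ks {rs} → k ≉ 0# → AllPairs _≉_ rs → All (λ r → poly (k ∷ ks) r ≈ 0#) rs →
    length rs ≤ length ks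
  roots≤degree ks k≉0 [] [] = z≤n
  roots≤degree {k} [] k≉0 _ (root ∷ _) =
    contradiction (trans (sym (trans (+-identityʳ _) (*-identityʳ k))) root) k≉0
  roots≤degree {k} (l ∷ ks) {r ∷ rs} k≉0 (r≉ ∷ rs≉) (root ∷ roots) =
    s≤s (subst (length rs ≤_) (length-divide r (l ⊕ r · k) ks) (roots≤degree (divide r (l ⊕ r · k) ks) k≉0 rs≉
      (All.zipWith (λ (r≉s , root′) → root-divide {ks = l ∷ ks} root (r≉s ∘ sym) root′) (r≉ , roots))))

  coefficients : Form ℕ → ℕ → List Carrier
  coefficients g zero = []
  coefficients g (suc m) = g (downFrom m) ∷ map (-1# ·_) (coefficients (g ∘ (m ∷_)) m)

  length-coefficients : ∀ g m → length (coefficients g m) ≡ m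
  length-coefficients g zero = ≡.refl
  length-coefficients g (suc m) = cong suc
    (≡.trans (List.length-map _ (coefficients (g ∘ (m ∷_)) m)) (length-coefficients (g ∘ (m ∷_)) m))

  ∧-poly : ∀ g m y → (pow y ∧ g) (downFrom m) ≈ poly (coefficients g m) y
  ∧-poly g zero y = refl
  ∧-poly g (suc m) y = +-cong
    (trans (*-comm _ _) (*-congˡ (reflexive (cong (y ^_) (≡.sym degree)))))
    (trans (*-congˡ (∧-poly (g ∘ (m ∷_)) m y)) (sym (poly-scale -1# (coefficients (g ∘ (m ∷_)) m) y)))
    where
    degree : length (map (-1# ·_) (coefficients (g ∘ (m ∷_)) m)) ≡ m
    degree = ℕ.suc-injective (length-coefficients g (suc m))

  -- As a function of y, the determinant for y ∷ ys is a polynomial of degree length ys with leading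
  -- coefficient the determinant for ys; it vanishes on ys, so it cannot also vanish at y.
  vandermonde≉0 : ∀ {ys} → AllPairs _≉_ ys → vandermonde ys (downFrom (length ys)) ≉ 0#
  vandermonde≉0 [] 1≈0 = 0≉1 (sym 1≈0)
  vandermonde≉0 {y ∷ ys} distinct@(_ ∷ ys-distinct) eq =
    ℕ.<-irrefl (ℕ.suc-injective (≡.sym (length-coefficients g (suc m))))
      (roots≤degree lower (vandermonde≉0 ys-distinct) distinct
        (root y eq ∷ All.tabulate (λ {z} z∈ys → root z (repeated-row z∈ys))))
    where
    m = length ys
    g = vandermonde ys
    lower = map (-1# ·_) (coefficients (g ∘ (m ∷_)) m)
    root : ∀ z → vandermonde (z ∷ ys) (downFrom (suc m)) ≈ 0# → poly (coefficients g (suc m)) z ≈ 0#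
    root z = trans (sym (∧-poly g (suc m) z))
    repeated-row : ∀ {z} → z ∈ ys → vandermonde (z ∷ ys) (downFrom (suc m)) ≈ 0#
    repeated-row z∈ys = repeated-∈ (rows-alternating unit (downFrom (suc m))) (∈-map⁺ pow z∈ys)

  alternant≉0 : ∀ {ys} → AllPairs _≉_ ys → alternant ys [] ≉ 0#
  alternant≉0 {ys} distinct eq = vandermonde≉0 distinct
    (trans (sym (alternant≈vandermonde ys [] ≡.refl (exponents-[] (length ys)))) eq)

  schur-· : ∀ {ys} μ → AllPairs _≉_ ys → alternant ys μ ≈ schur ys μ · alternant ys []
  schur-· {ys} μ distinct = begin
    v                   ≈⟨ *-identityʳ v ⟨
    v · 1#              ≈⟨ *-congˡ (⁻¹-inverse v₀ (alternant≉0 distinct)) ⟨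
    v · (v₀ · v₀ ⁻¹)    ≈⟨ solve 3 (λ v w i → v :* (w :* i) := (v :* i) :* w) refl v v₀ (v₀ ⁻¹) ⟩
    (v · v₀ ⁻¹) · v₀    ∎
    where
    v = alternant ys μ
    v₀ = alternant ys []

  schur-unique : ∀ {ys} μ {z} → AllPairs _≉_ ys → alternant ys μ ≈ z · alternant ys [] → schur ys μ ≈ z
  schur-unique {ys} μ distinct eq = ·-cancelˡ (alternant≉0 distinct)
    (trans (*-comm _ _) (trans (trans (sym (schur-· μ distinct)) eq) (*-comm _ _)))

module ColumnSorting {a ℓ} (R : CommutativeRing a ℓ) (t : ℕ) .{{t≢0 : NonZero t}} where
  open CommutativeRing R using (Carrier; _≈_; *-congˡ; setoid) renaming (_*_ to _·_)
  open AlternatingForms R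
  open ExteriorProduct R
  open Residues t
  open import Relation.Binary.Reasoning.Setoid setoid

  sort-columns : ∀ {c} lam → c < t → ∀ (rs : List (ℕ → Carrier)) →
    det rs (beta lam) ≈ sign (inversions (sigmaList t c lam)) · det rs (arrange c (beta lam))
  sort-columns {c} lam c<t rs = begin
    det rs (beta lam)                 ≡⟨ cong (det rs) (map-at (beta lam)) ⟨
    g (upTo (length (beta lam)))      ≡⟨ cong (g ∘ upTo) (length-beta lam) ⟩
    g (upTo (length lam))             ≈⟨ sign-·-sign-· (inversions σ) _ ⟨
    sign (inversions σ) · (sign (inversions σ) · g (upTo (length lam)))
      ≈⟨ *-congˡ (sort-sign (antisymmetric-map (columns-antisymmetric rs) (at (beta lam)))
           (AllPairs.applyUpTo⁺₁ id (length lam) (λ i<j _ → i<j)) (sigmaList-↭ lam c<t)) ⟨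
    sign (inversions σ) · g σ         ≡⟨ cong (λ l → sign (inversions σ) · det rs l) (map-sigmaList c lam) ⟩
    sign (inversions σ) · det rs (arrange c (beta lam)) ∎
    where
    σ = sigmaList t c lam
    g : Form ℕ
    g l = det rs (map (at (beta lam)) l)

  sort-columns-∅ : ∀ n (rs : List (ℕ → Carrier)) →
    det rs (downFrom (t * n + 1)) ≈ sign (triangle t * triangle (suc n)) · det rs (arrange 0 (rowBeta 0 n))
  sort-columns-∅ n rs = begin
    det rs (downFrom (t * n + 1))
      ≡⟨ cong (det rs ∘ downFrom) (ℕ.+-comm (t * n) 1) ⟩
    det rs (t * n ∷ downFrom (t * n))
      ≡⟨ cong (λ b → det rs (b ∷ downFrom (t * n))) (ℕ.+-identityʳ (t * n)) ⟨
    det rs (t * n + 0 ∷ downFrom (t * n))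
      ≈⟨ transpose-sign (antisymmetric-∷ (columns-antisymmetric rs) (t * n + 0)) t n ⟩
    s · det rs (t * n + 0 ∷ concatMap (λ i → runner t i n) (upTo t))
      ≡⟨ cong (λ L → s · det rs (t * n + 0 ∷ concatMap (λ i → runner t i n) L)) 0∷others ⟩
    s · det rs (runner t 0 (suc n) ++ concatMap (λ i → runner t i n) (others 0))
      ≡⟨ cong (λ B → s · det rs B) (arrange-rowBeta n 0<t) ⟨
    s · det rs (arrange 0 (rowBeta 0 n)) ∎
    where
    s = sign (triangle t * triangle (suc n))
    0∷others : upTo t ≡ 0 ∷ others 0
    0∷others = ≡.trans (upTo-split 0<t) (cong (0 ∷_) (≡.sym (others-split 0<t)))

module ResidueRows {a ℓ} (F : Field a ℓ) (t : ℕ) .{{t≢0 : NonZero t}} where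
  open FieldOps F hiding (det)
  open ExteriorProduct commutativeRing
  open Vandermonde F
  open Residues t
  open BigOperator *-commutativeMonoid using () renaming (fold to ∏)
  open import Relation.Binary.Reasoning.Setoid setoid

  residueRow : ℕ → Carrier → ℕ → Carrier
  residueRow i y e = if does (residue? i e) then y ^ e else 0#

  residueRow-≡ : ∀ {i} y e → e % t ≡ i → residueRow i y e ≈ y ^ e
  residueRow-≡ {i} y e e%t≡i rewrite dec-true (residue? i e) e%t≡i = refl

  residueRow-≢ : ∀ {i} y e → e % t ≢ i → residueRow i y e ≈ 0#
  residueRow-≢ {i} y e e%t≢i rewrite dec-false (residue? i e) e%t≢i = refl

  vandermonde-class : ∀ {i} ys B →
    vandermonde ys (class i B) ≈ ∏ (_^ i) ys · vandermonde (map (_^ t) ys) (classQuotients i B)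
  vandermonde-class {i} ys B = begin
    det (map pow ys) (class i B)
      ≈⟨ ⋀-cong (Pointwise.map⁺ _ _ (Pointwise.refl (λ {y} → split y) {x = ys}))
           (λ _ _ → refl) (class-residue i B) ⟩
    det (map (λ y e → y ^ i · pow (y ^ t) (e / t)) ys) (class i B)
      ≈⟨ ⋀-scale (_^ i) (λ y → pow (y ^ t) ∘ (_/ t)) unit ys (class i B) ⟩
    ∏ (_^ i) ys · det (map (λ y → pow (y ^ t) ∘ (_/ t)) ys) (class i B)
      ≈⟨ *-congˡ (det-map (_/ t) (pow ∘ (_^ t)) ys (class i B)) ⟩
    ∏ (_^ i) ys · det (map (pow ∘ (_^ t)) ys) (classQuotients i B)
      ≡⟨ cong (λ rs → ∏ (_^ i) ys · det rs (classQuotients i B)) (List.map-∘ ys) ⟩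
    ∏ (_^ i) ys · vandermonde (map (_^ t) ys) (classQuotients i B) ∎
    where
    split : ∀ y e → e % t ≡ i → y ^ e ≈ y ^ i · (y ^ t) ^ (e / t)
    split y e e%t≡i = begin
      y ^ e                          ≡⟨ cong (y ^_) (ℕ.m≡m%n+[m/n]*n e t) ⟩
      y ^ (e % t + e / t * t)        ≡⟨ cong₂ (λ r k → y ^ (r + k)) e%t≡i (ℕ.*-comm (e / t) t) ⟩
      y ^ (i + t * (e / t))          ≈⟨ ^-homo-* y i (t * (e / t)) ⟩
      y ^ i · y ^ (t * (e / t))      ≈⟨ *-congˡ (^-assocʳ y t (e / t)) ⟨
      y ^ i · (y ^ t) ^ (e / t)      ∎

module PrimitiveRoot {a ℓ} (F : Field a ℓ) (t : ℕ) .{{t≢0 : NonZero t}} {ω : Field.Carrier F}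
    (ω-primitive : FieldOps.Primitive F t ω) where
  open FieldOps F hiding (det)
  open Vandermonde F
  open import Relation.Binary.Reasoning.Setoid setoid

  ω^[i*t]≈1 : ∀ i → ω ^ (i * t) ≈ 1#
  ω^[i*t]≈1 i = begin
    ω ^ (i * t)   ≡⟨ cong (ω ^_) (ℕ.*-comm i t) ⟩
    ω ^ (t * i)   ≈⟨ ^-assocʳ ω t i ⟨
    (ω ^ t) ^ i   ≈⟨ ^-congˡ i (proj₁ ω-primitive) ⟩
    1# ^ i        ≈⟨ 1^n≈1 i ⟩
    1#            ∎

  ω^-% : ∀ e → ω ^ e ≈ ω ^ (e % t)
  ω^-% e = begin
    ω ^ e                          ≡⟨ cong (ω ^_) (ℕ.m≡m%n+[m/n]*n e t) ⟩
    ω ^ (e % t + e / t * t)        ≈⟨ ^-homo-* ω (e % t) _ ⟩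
    ω ^ (e % t) · ω ^ (e / t * t)  ≈⟨ *-congˡ (ω^[i*t]≈1 (e / t)) ⟩
    ω ^ (e % t) · 1#               ≈⟨ *-identityʳ _ ⟩
    ω ^ (e % t)                    ∎

  ω^i·ω^[j∸i]≈ω^j : ∀ {i j} → i ≤ j → ω ^ i · ω ^ (j ∸ i) ≈ ω ^ j
  ω^i·ω^[j∸i]≈ω^j {i} {j} i≤j = trans (sym (^-homo-* ω i (j ∸ i))) (reflexive (cong (ω ^_) (ℕ.m+[n∸m]≡n i≤j)))

  ω^i≉0 : ∀ {i} → i < t → ω ^ i ≉ 0#
  ω^i≉0 {i} i<t ω^i≈0 = 0≉1 (begin
    0#                    ≈⟨ zeroˡ _ ⟨
    0# · ω ^ (t ∸ i)      ≈⟨ *-congʳ ω^i≈0 ⟨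
    ω ^ i · ω ^ (t ∸ i)   ≈⟨ ω^i·ω^[j∸i]≈ω^j (ℕ.<⇒≤ i<t) ⟩
    ω ^ t                 ≈⟨ proj₁ ω-primitive ⟩
    1#                    ∎)

  ω^-≉ : ∀ {i j} → i < j → j < t → ω ^ i ≉ ω ^ j
  ω^-≉ {i} {j} i<j j<t ω^i≈ω^j =
    proj₂ ω-primitive (j ∸ i) (ℕ.m<n⇒0<n∸m i<j) (ℕ.≤-<-trans (ℕ.m∸n≤m j i) j<t)
      (·-cancelˡ (ω^i≉0 (ℕ.<-trans i<j j<t)) (begin
        ω ^ i · ω ^ (j ∸ i)   ≈⟨ ω^i·ω^[j∸i]≈ω^j (ℕ.<⇒≤ i<j) ⟩
        ω ^ j                 ≈⟨ ω^i≈ω^j ⟨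
        ω ^ i                 ≈⟨ *-identityʳ _ ⟨
        ω ^ i · 1#            ∎))

  ω^-injective : ∀ {i j} → i < t → j < t → ω ^ i ≈ ω ^ j → i ≡ j
  ω^-injective {i} {j} i<t j<t ω^i≈ω^j with ℕ.<-cmp i j
  ... | tri< i<j _ _ = contradiction ω^i≈ω^j (ω^-≉ i<j j<t)
  ... | tri≈ _ i≡j _ = i≡j
  ... | tri> _ _ j<i = contradiction (sym ω^i≈ω^j) (ω^-≉ j<i i<t)

module Specialisation {a ℓ} (F : Field a ℓ) (t n : ℕ) .{{t≢0 : NonZero t}} (ω : Field.Carrier F)
    (ω-primitive : FieldOps.Primitive F t ω) (x : Fin n → Field.Carrier F) where
  open FieldOps F hiding (det)
  open AlternatingForms commutativeRing
  open ExteriorProduct commutativeRing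
  open Vandermonde F
  open Residues t
  open ColumnSorting commutativeRing t
  open ResidueRows F t
  open PrimitiveRoot F t ω-primitive
  open BigOperator +-commutativeMonoid using () renaming (fold-single to ∑-single)
  open BigOperator *-commutativeMonoid
    renaming (fold to ∏; fold-cong to ∏-cong; fold-∙ to ∏-·; fold-↭ to ∏-↭; fold-++-single to ∏-++-single)
  open DecMembership ℕ._≟_ using (_∈?_)
  open import Algebra.Solver.Ring.NaturalCoefficients.Default commutativeSemiring using (solve; _:=_; _:*_)
  open import Relation.Binary.Reasoning.Setoid setoid

  points : List Carrier
  points = spec t n ω x

  X : List Carrier
  X = map x (allFin n)

  Xᵗ : List Carrier
  Xᵗ = powVars t n x

  Xᵗ,1 : List Carrier
  Xᵗ,1 = Xᵗ ++ 1# ∷ []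

  length-map-allFin : ∀ {b} {B : Set b} (f : Fin n → B) → length (map f (allFin n)) ≡ n
  length-map-allFin f = ≡.trans (List.length-map f (allFin n)) (List.length-tabulate id)

  length-Xᵗ : length Xᵗ ≡ n
  length-Xᵗ = length-map-allFin _

  length-Xᵗ,1 : length Xᵗ,1 ≡ suc n
  length-Xᵗ,1 = ≡.trans (List.length-++ Xᵗ) (≡.trans (ℕ.+-comm (length Xᵗ) 1) (cong suc length-Xᵗ))

  rows : ℕ → List (ℕ → Carrier)
  rows i = map (residueRow i ∘ x) (allFin n)

  one : List (ℕ → Carrier)
  one = pow 1# ∷ []

  residueRows : List (ℕ → Carrier)
  residueRows = concatMap rows (upTo t) ++ one

  length-rows : ∀ i → length (rows i) ≡ n
  length-rows i = length-map-allFin (residueRow i ∘ x)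

  length-concatMap-rows : ∀ L → length (concatMap rows L) ≡ length L * n
  length-concatMap-rows L = length-concatMap (All.tabulate {xs = L} λ {i} _ → length-rows i)

  rows-ZeroOn : ∀ {P : Pred ℕ Level.zero} {i} → ¬ P i → All (ZeroOn (λ e → P (e % t))) (rows i)
  rows-ZeroOn {P} ¬pi = All.map⁺ (All.tabulate {xs = allFin n} λ {b} _ e pe →
    residueRow-≢ (x b) e (λ e%t≡i → ¬pi (subst P e%t≡i pe)))

  -- The discrete Fourier transform of the rows

  indices : List (ℕ × Fin n)
  indices = cartesianProduct (upTo t) (allFin n)

  indices-unique : Unique indices
  indices-unique = Unique.cartesianProduct⁺ (Unique.upTo⁺ t) (Unique.allFin⁺ n)

  node : ℕ × Fin n → Carrier
  node (i , b) = ω ^ i · x b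

  points≡ : points ≡ map node indices ++ 1# ∷ []
  points≡ = cong (_++ 1# ∷ []) (≡.sym (map-cartesianProduct node (upTo t) (allFin n)))

  length-points : length points ≡ t * n + 1
  length-points = ≡.trans (cong length points≡) (≡.trans (List.length-++ (map node indices))
    (cong (_+ 1) (≡.trans (List.length-map node indices) (≡.trans (length-cartesianProduct (upTo t) (allFin n))
      (cong₂ _*_ (List.length-upTo t) (List.length-tabulate id))))))

  indexedRow : ℕ × Fin n → ℕ → Carrier
  indexedRow (i , b) = residueRow i (x b)

  fourier : ℕ × Fin n → ℕ × Fin n → Carrier
  fourier (i , b) (j , b′) = if does (b Fin.≟ b′) then ω ^ (i * j) else 0#

  fourier-diagonal : ∀ i b e → fourier (i , b) (e % t , b) · indexedRow (e % t , b) e ≈ node (i , b) ^ e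
  fourier-diagonal i b e rewrite dec-true (b Fin.≟ b) ≡.refl = begin
    ω ^ (i * r) · residueRow r (x b) e   ≈⟨ *-congˡ (residueRow-≡ (x b) e ≡.refl) ⟩
    ω ^ (i * r) · x b ^ e                ≡⟨ cong (λ k → ω ^ k · x b ^ e) (ℕ.*-comm i r) ⟩
    ω ^ (r * i) · x b ^ e                ≈⟨ *-congʳ (^-assocʳ ω r i) ⟨
    (ω ^ r) ^ i · x b ^ e                ≈⟨ *-congʳ (^-congˡ i (ω^-% e)) ⟨
    (ω ^ e) ^ i · x b ^ e                ≈⟨ *-congʳ (^-assocʳ ω e i) ⟩
    ω ^ (e * i) · x b ^ e                ≡⟨ cong (λ k → ω ^ k · x b ^ e) (ℕ.*-comm e i) ⟩
    ω ^ (i * e) · x b ^ e                ≈⟨ *-congʳ (^-assocʳ ω i e) ⟨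
    (ω ^ i) ^ e · x b ^ e                ≈⟨ ^-distrib-* (ω ^ i) (x b) e ⟨
    (ω ^ i · x b) ^ e                    ∎
    where
    r = e % t

  fourier-off-diagonal : ∀ k b e l → l ≢ (e % t , b) → fourier (k , b) l · indexedRow l e ≈ 0#
  fourier-off-diagonal k b e (j , b′) l≢ with b Fin.≟ b′
  ... | no _ = zeroˡ _
  ... | yes ≡.refl = trans (*-congˡ (residueRow-≢ (x b) e (λ e%t≡j → l≢ (cong (_, b) (≡.sym e%t≡j))))) (zeroʳ _)

  pow-node : ∀ k e → pow (node k) e ≈ combine indices indexedRow (fourier k) e
  pow-node (i , b) e = sym (trans
    (∑-single indices-unique residue∈ (fourier-off-diagonal i b e))
    (fourier-diagonal i b e))
    where
    residue∈ : (e % t , b) ∈ indices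
    residue∈ = ∈-cartesianProduct⁺ (∈-upTo⁺ (ℕ.m%n<n e t)) (∈-allFin b)

  DFT : Carrier
  DFT = det (map fourier indices) indices

  vandermonde-points : ∀ B → vandermonde points B ≈ DFT · det residueRows B
  vandermonde-points B = begin
    vandermonde points B
      ≡⟨ cong (λ rs → det rs B) pow-points≡ ⟩
    det (map (pow ∘ node) indices ++ one) B
      ≡⟨ ⋀-++ (map (pow ∘ node) indices) one unit B ⟩
    ⋀ (map (pow ∘ node) indices) (det one) B
      ≈⟨ ⋀-map-cong pow-node indices (det one) B ⟩
    ⋀ (map (combine indices indexedRow ∘ fourier) indices) (det one) B
      ≡⟨ cong (λ rs → ⋀ rs (det one) B) (List.map-∘ indices) ⟩
    ⋀ (map (combine indices indexedRow) (map fourier indices)) (det one) B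
      ≈⟨ ⋀-combine indices indexedRow (map fourier indices) (det one) B
           (≡.sym (List.length-map fourier indices)) ⟩
    DFT · ⋀ (map indexedRow indices) (det one) B
      ≡⟨ cong (λ rs → DFT · ⋀ rs (det one) B) (map-cartesianProduct indexedRow (upTo t) (allFin n)) ⟩
    DFT · ⋀ (concatMap rows (upTo t)) (det one) B
      ≡⟨ cong (DFT ·_) (⋀-++ (concatMap rows (upTo t)) one unit B) ⟨
    DFT · det residueRows B ∎
    where
    pow-points≡ : map pow points ≡ map (pow ∘ node) indices ++ one
    pow-points≡ = ≡.trans (cong (map pow) points≡)
      (≡.trans (List.map-++ pow (map node indices) (1# ∷ [])) (cong (_++ one) (≡.sym (List.map-∘ indices))))

  -- Vanishing for cores with more than one row

  rows-vanish : ∀ {P : Pred ℕ Level.zero} (P? : Decidable P) L {k g} → VanishesFrom (P? ∘ (_% t)) k g →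
    VanishesFrom (P? ∘ (_% t)) (count P? L * n + k) (⋀ (concatMap rows L) g)
  rows-vanish P? [] g≈0 = g≈0
  rows-vanish P? (i ∷ L) {k} {g} g≈0 l k≤ rewrite ⋀-++ (rows i) (concatMap rows L) g l with P? i
  ... | yes _ = ⋀-vanishes (P? ∘ (_% t)) (rows i) (rows-vanish P? L g≈0) l
          (subst (_≤ count (P? ∘ (_% t)) l) rows+rest k≤)
    where
    rows+rest : n + count P? L * n + k ≡ length (rows i) + (count P? L * n + k)
    rows+rest = ≡.trans (ℕ.+-assoc n (count P? L * n) k)
      (cong (_+ (count P? L * n + k)) (≡.sym (length-rows i)))
  ... | no ¬pi = ⋀-vanishes-ZeroOn (P? ∘ (_% t)) (rows-ZeroOn ¬pi) (rows-vanish P? L g≈0) l k≤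

  det-residueRows-vanishes : ∀ {L} B → Unique L → length L * n + 2 ≤ length (concatMap (λ i → class i B) L) →
    det residueRows B ≈ 0#
  det-residueRows-vanishes {L} B uL crowded = trans (reflexive (⋀-++ (concatMap rows (upTo t)) one unit B))
    (rows-vanish (_∈? L) (upTo t) (⋀-vanishes residue∈L? one (unit-vanishes residue∈L?)) B
      (ℕ.≤-trans (ℕ.+-monoˡ-≤ 2 (ℕ.*-monoˡ-≤ n residues≤)) (subst (length L * n + 2 ≤_) columns≡ crowded)))
    where
    residue∈L? : Decidable (λ e → e % t ∈ L)
    residue∈L? e = e % t ∈? L
    residues≤ : count (_∈? L) (upTo t) ≤ length L
    residues≤ = Unique-⊆⇒length≤ (Unique.filter⁺ (_∈? L) (Unique.upTo⁺ t))
      (proj₂ ∘ ∈-filter⁻ (_∈? L) {xs = upTo t})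
    columns≡ : length (concatMap (λ i → class i B) L) ≡ count residue∈L? B
    columns≡ = Perm.↭-length (concatMap-fibres ℕ._≟_ (_% t) B uL)

  -- Factorisation for the core (c)

  sort-rows : ∀ {c} → c < t → ∀ B →
    det residueRows B ≈ sign (c * (n * n) + (t ∸ 1) * n) · det ((rows c ++ one) ++ concatMap rows (others c)) B
  sort-rows {c} c<t B = begin
    g residueRows
      ≡⟨ cong g split-rows ⟩
    g (pre ++ rows c ++ post ++ one)
      ≈⟨ move-block anti pre (rows c) (post ++ one) ⟩
    sign (length pre * length (rows c)) · g (rows c ++ pre ++ post ++ one)
      ≡⟨ cong₂ (λ k rs → sign k · g (rows c ++ rs)) |pre|*|rows|≡ join-rows ⟩
    sign (c * (n * n)) · g (rows c ++ rest ++ one)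
      ≈⟨ *-congˡ (move-to-front (antisymmetric-++ anti (rows c)) rest (pow 1#) []) ⟩
    sign (c * (n * n)) · (sign (length rest) · g (rows c ++ one ++ rest ++ []))
      ≈⟨ trans (*-congʳ (sign-+ (c * (n * n)) (length rest))) (*-assoc _ _ _) ⟨
    sign (c * (n * n) + length rest) · g (rows c ++ one ++ rest ++ [])
      ≡⟨ cong₂ (λ k rs → sign (c * (n * n) + k) · g rs) |rest|≡ regroup ⟩
    sign (c * (n * n) + (t ∸ 1) * n) · g ((rows c ++ one) ++ rest) ∎
    where
    g : Form (ℕ → Carrier)
    g rs = det rs B
    anti : Antisymmetric g
    anti = Alternating.antisymmetric (rows-alternating unit B)
    pre = concatMap rows (upTo c)
    post = concatMap rows (above c)
    rest = concatMap rows (others c)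
    split-rows : residueRows ≡ pre ++ rows c ++ post ++ one
    split-rows rewrite upTo-split c<t | List.concatMap-++ rows (upTo c) (c ∷ above c)
      | List.++-assoc pre (rows c ++ post) one | List.++-assoc (rows c) post one = ≡.refl
    join-rows : pre ++ post ++ one ≡ rest ++ one
    join-rows rewrite others-split c<t | List.concatMap-++ rows (upTo c) (above c) =
      ≡.sym (List.++-assoc pre post one)
    regroup : rows c ++ one ++ rest ++ [] ≡ (rows c ++ one) ++ rest
    regroup rewrite List.++-identityʳ rest = ≡.sym (List.++-assoc (rows c) one rest)
    |pre|*|rows|≡ : length pre * length (rows c) ≡ c * (n * n)
    |pre|*|rows|≡ rewrite length-concatMap-rows (upTo c) | List.length-upTo c | length-rows c = ℕ.*-assoc c n n
    |rest|≡ : length rest ≡ (t ∸ 1) * n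
    |rest|≡ = ≡.trans (length-concatMap-rows (others c)) (cong (_* n) (length-others c<t))

  monomial : ℕ → Carrier
  monomial i = ∏ (_^ i) X

  map-^t-X : map (_^ t) X ≡ Xᵗ
  map-^t-X = ≡.sym (List.map-∘ (allFin n))

  rows-on-class : ∀ i → Pointwise (λ r r′ → ∀ e → e % t ≡ i → r e ≈ r′ e) (rows i) (map pow X)
  rows-on-class i = subst (Pointwise _ (rows i)) (List.map-∘ (allFin n))
    (Pointwise.map⁺ _ _ (Pointwise.refl (λ {b} → residueRow-≡ (x b)) {x = allFin n}))

  det-rows : ∀ i B → det (rows i) (class i B) ≈ monomial i · vandermonde Xᵗ (classQuotients i B)
  det-rows i B = begin
    det (rows i) (class i B)
      ≈⟨ ⋀-cong (rows-on-class i) (λ _ _ → refl) (class-residue i B) ⟩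
    vandermonde X (class i B)
      ≈⟨ vandermonde-class X B ⟩
    monomial i · vandermonde (map (_^ t) X) (classQuotients i B)
      ≡⟨ cong (λ ys → monomial i · vandermonde ys (classQuotients i B)) map-^t-X ⟩
    monomial i · vandermonde Xᵗ (classQuotients i B) ∎

  det-rows-one : ∀ i B → det (rows i ++ one) (class i B) ≈ monomial i · vandermonde Xᵗ,1 (classQuotients i B)
  det-rows-one i B = begin
    det (rows i ++ one) (class i B)
      ≈⟨ ⋀-cong (Pointwise.++⁺ (rows-on-class i) ((λ _ _ → refl) ∷ [])) (λ _ _ → refl) (class-residue i B) ⟩
    det (map pow X ++ one) (class i B)
      ≡⟨ cong (λ rs → det rs (class i B)) (List.map-++ pow X (1# ∷ [])) ⟨
    vandermonde (X ++ 1# ∷ []) (class i B)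
      ≈⟨ vandermonde-class (X ++ 1# ∷ []) B ⟩
    ∏ (_^ i) (X ++ 1# ∷ []) · vandermonde (map (_^ t) (X ++ 1# ∷ [])) (classQuotients i B)
      ≡⟨ cong (λ ys → ∏ (_^ i) (X ++ 1# ∷ []) · vandermonde ys (classQuotients i B)) map-^t-X,1 ⟩
    ∏ (_^ i) (X ++ 1# ∷ []) · vandermonde (Xᵗ ++ 1# ^ t ∷ []) (classQuotients i B)
      ≈⟨ *-cong (∏-++-single (_^ i) X (1^n≈1 i))
           (vandermonde-cong (Pointwise.++⁺ (Pointwise.refl refl {x = Xᵗ}) (1^n≈1 t ∷ []))
             (classQuotients i B)) ⟩
    monomial i · vandermonde Xᵗ,1 (classQuotients i B) ∎
    where
    map-^t-X,1 : map (_^ t) (X ++ 1# ∷ []) ≡ Xᵗ ++ 1# ^ t ∷ []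
    map-^t-X,1 = ≡.trans (List.map-++ (_^ t) X (1# ∷ [])) (cong (_++ 1# ^ t ∷ []) map-^t-X)

  vandermondeProduct : ℕ → List ℕ → Carrier
  vandermondeProduct c B =
    vandermonde Xᵗ,1 (classQuotients c B) · ∏ (λ i → vandermonde Xᵗ (classQuotients i B)) (others c)

  det-others : ∀ {c} B → RowCoreSizes c n B →
    det (concatMap rows (others c)) (concatMap (λ i → class i B) (others c))
      ≈ ∏ monomial (others c) · ∏ (λ i → vandermonde Xᵗ (classQuotients i B)) (others c)
  det-others {c} B (_ , |class|≡n) = begin
    det (concatMap rows (others c)) (concatMap (λ i → class i B) (others c))
      ≈⟨ det-block-triangular residue? rows (λ i → class i B)
           (AllPairs.map (λ i≢j → rows-ZeroOn (i≢j ∘ ≡.sym)) (others-unique c))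
           (All.zipWith (λ (i<t , c≢i) → square-block i<t c≢i) (others-< c , others-≢ c)) ⟩
    ∏ (λ i → det (rows i) (class i B)) (others c)
      ≈⟨ ∏-cong (All.tabulate {xs = others c} λ {i} _ → det-rows i B) ⟩
    ∏ (λ i → monomial i · vandermonde Xᵗ (classQuotients i B)) (others c)
      ≈⟨ ∏-· (others c) ⟩
    ∏ monomial (others c) · ∏ (λ i → vandermonde Xᵗ (classQuotients i B)) (others c) ∎
    where
    square-block : ∀ {i} → i < t → c ≢ i →
      All (λ e → e % t ≡ i) (class i B) × length (class i B) ≡ length (rows i)
    square-block {i} i<t c≢i = class-residue i B , ≡.trans (|class|≡n i<t c≢i) (≡.sym (length-rows i))

  det-arranged : ∀ {c} → c < t → ∀ B → RowCoreSizes c n B →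
    det ((rows c ++ one) ++ concatMap rows (others c)) (arrange c B)
      ≈ ∏ monomial (upTo t) · vandermondeProduct c B
  det-arranged {c} c<t B sizes = begin
    det ((rows c ++ one) ++ concatMap rows L) (arrange c B)
      ≈⟨ det-block (residue? c) (rows c ++ one) rest-ZeroOn (class c B) _ (class-residue c B) square-block ⟩
    det (rows c ++ one) (class c B) · det (concatMap rows L) (concatMap (λ i → class i B) L)
      ≈⟨ *-cong (det-rows-one c B) (det-others B sizes) ⟩
    (monomial c · vandermonde Xᵗ,1 (classQuotients c B))
      · (∏ monomial L · ∏ (λ i → vandermonde Xᵗ (classQuotients i B)) L)
      ≈⟨ solve 4 (λ m v p q → (m :* v) :* (p :* q) := (m :* p) :* (v :* q)) refl _ _ _ _ ⟩
    ∏ monomial (c ∷ L) · vandermondeProduct c B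
      ≈⟨ *-congʳ (∏-↭ monomial (c∷others↭upTo c<t)) ⟩
    ∏ monomial (upTo t) · vandermondeProduct c B ∎
    where
    L = others c
    rest-ZeroOn : All (ZeroOn (λ e → e % t ≡ c)) (concatMap rows L)
    rest-ZeroOn = All.concat⁺ (All.map⁺ (All.map (λ c≢i → rows-ZeroOn (c≢i ∘ ≡.sym)) (others-≢ c)))
    square-block : length (class c B) ≡ length (rows c ++ one)
    square-block rewrite List.length-++ (rows c) {one} | length-rows c | ℕ.+-comm n 1 = proj₁ sizes

  vandermonde-points-arranged : ∀ {c} → c < t → ∀ B → RowCoreSizes c n B → vandermonde points (arrange c B) ≈
    DFT · (sign (c * (n * n) + (t ∸ 1) * n) · (∏ monomial (upTo t) · vandermondeProduct c B))
  vandermonde-points-arranged {c} c<t B sizes = trans (vandermonde-points (arrange c B))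
    (*-congˡ (trans (sort-rows c<t (arrange c B)) (*-congˡ (det-arranged c<t B sizes))))

  alternantProduct : ℕ → List ℕ → Carrier
  alternantProduct c lam =
    alternant Xᵗ,1 (quotient t c lam) · ∏ (λ i → alternant Xᵗ (quotient t i lam)) (others c)

  vandermondeProduct-beta : ∀ {c} lam → Decreasing lam → RowCoreSizes c n (beta lam) →
    vandermondeProduct c (beta lam) ≈ alternantProduct c lam
  vandermondeProduct-beta {c} lam dec (size-c , size-others) = *-cong
    (sym (alternant≈vandermonde Xᵗ,1 (quotient t c lam) length-Xᵗ,1 (exponents-quotient c lam dec size-c)))
    (∏-cong (All.zipWith
      (λ {i} (i<t , c≢i) → sym (alternant≈vandermonde Xᵗ (quotient t i lam) length-Xᵗ
        (exponents-quotient i lam dec (size-others i<t c≢i))))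
      (others-< c , others-≢ c)))

  emptyProduct : Carrier
  emptyProduct = alternant Xᵗ,1 [] · alternant Xᵗ [] ^ (t ∸ 1)

  vandermondeProduct-∅ : vandermondeProduct 0 (rowBeta 0 n) ≈ emptyProduct
  vandermondeProduct-∅ = *-cong
    (sym (alternant≈vandermonde Xᵗ,1 [] length-Xᵗ,1 (≡.trans (exponents-[] (suc n)) (≡.sym classQuotients-0))))
    (begin
      ∏ (λ i → vandermonde Xᵗ (classQuotients i (rowBeta 0 n))) (others 0)
        ≈⟨ ∏-cong (All.zipWith (λ (i<t , 0≢i) → sym (alternant≈vandermonde Xᵗ [] length-Xᵗ
             (≡.trans (exponents-[] n) (≡.sym (classQuotients-i i<t 0≢i))))) (others-< 0 , others-≢ 0)) ⟩
      ∏ (λ _ → alternant Xᵗ []) (others 0)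
        ≈⟨ ∏-const (alternant Xᵗ []) (others 0) ⟩
      alternant Xᵗ [] ^ length (others 0)
        ≡⟨ cong (alternant Xᵗ [] ^_) (length-others 0<t) ⟩
      alternant Xᵗ [] ^ (t ∸ 1) ∎)
    where
    classQuotients-0 : classQuotients 0 (rowBeta 0 n) ≡ downFrom (suc n)
    classQuotients-0 = ≡.trans (cong (map (_/ t)) (class-rowBeta-≡ n 0<t)) (runner-/ 0<t (suc n))
    classQuotients-i : ∀ {i} → i < t → 0 ≢ i → classQuotients i (rowBeta 0 n) ≡ downFrom n
    classQuotients-i i<t 0≢i = ≡.trans (cong (map (_/ t)) (class-rowBeta-≢ n 0<t i<t 0≢i)) (runner-/ i<t n)

  alternant-points : ∀ lam → length lam ≡ t * n + 1 → alternant points lam ≈ vandermonde points (beta lam)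
  alternant-points lam len = alternant≈vandermonde points lam length-points (exponents≡beta len)

  alternant-points-row-core : ∀ {c} lam → c < t → length lam ≡ t * n + 1 → Decreasing lam →
    RowCoreSizes c n (beta lam) →
    alternant points lam ≈ sign (inversions (sigmaList t c lam))
      · (DFT · (sign (c * (n * n) + (t ∸ 1) * n) · (∏ monomial (upTo t) · alternantProduct c lam)))
  alternant-points-row-core {c} lam c<t len dec sizes = begin
    alternant points lam
      ≈⟨ alternant-points lam len ⟩
    vandermonde points (beta lam)
      ≈⟨ sort-columns lam c<t (map pow points) ⟩
    s · vandermonde points (arrange c (beta lam))
      ≈⟨ *-congˡ (vandermonde-points-arranged c<t (beta lam) sizes) ⟩
    s · (DFT · (sign (c * (n * n) + (t ∸ 1) * n) · (∏ monomial (upTo t) · vandermondeProduct c (beta lam))))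
      ≈⟨ *-congˡ (*-congˡ (*-congˡ (*-congˡ (vandermondeProduct-beta lam dec sizes)))) ⟩
    s · (DFT · (sign (c * (n * n) + (t ∸ 1) * n) · (∏ monomial (upTo t) · alternantProduct c lam))) ∎
    where
    s = sign (inversions (sigmaList t c lam))

  alternant-points-∅ : alternant points [] ≈
    sign (triangle t * triangle (suc n)) · (DFT · (sign ((t ∸ 1) * n) · (∏ monomial (upTo t) · emptyProduct)))
  alternant-points-∅ = begin
    alternant points []
      ≈⟨ alternant≈vandermonde points [] length-points (exponents-[] (t * n + 1)) ⟩
    vandermonde points (downFrom (t * n + 1))
      ≈⟨ sort-columns-∅ n (map pow points) ⟩
    s · vandermonde points (arrange 0 (rowBeta 0 n))
      ≈⟨ *-congˡ (vandermonde-points-arranged 0<t (rowBeta 0 n) (rowBeta-sizes n 0<t)) ⟩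
    s · (DFT · (sign ((t ∸ 1) * n) · (∏ monomial (upTo t) · vandermondeProduct 0 (rowBeta 0 n))))
      ≈⟨ *-congˡ (*-congˡ (*-congˡ (*-congˡ vandermondeProduct-∅))) ⟩
    s · (DFT · (sign ((t ∸ 1) * n) · (∏ monomial (upTo t) · emptyProduct))) ∎
    where
    s = sign (triangle t * triangle (suc n))

  module _ (x≉0 : ∀ i → x i ≉ 0#) (x^t-injective : ∀ i j → x i ^ t ≈ x j ^ t → i ≡ j)
           (x^t≉1 : ∀ i → x i ^ t ≉ 1#) where

    node-^t : ∀ i b → node (i , b) ^ t ≈ x b ^ t
    node-^t i b = begin
      (ω ^ i · x b) ^ t       ≈⟨ ^-distrib-* (ω ^ i) (x b) t ⟩
      (ω ^ i) ^ t · x b ^ t   ≈⟨ *-congʳ (trans (^-assocʳ ω i t) (ω^[i*t]≈1 i)) ⟩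
      1# · x b ^ t            ≈⟨ *-identityˡ _ ⟩
      x b ^ t                 ∎

    node-injective : ∀ {i b j b′} → i < t → j < t → node (i , b) ≈ node (j , b′) → (i , b) ≡ (j , b′)
    node-injective {i} {b} {j} {b′} i<t j<t eq
      with ≡.refl ← x^t-injective b b′ (trans (sym (node-^t i b)) (trans (^-congˡ t eq) (node-^t j b′))) =
      cong (_, b) (ω^-injective i<t j<t (·-cancelˡ (x≉0 b) (trans (*-comm _ _) (trans eq (*-comm _ _)))))

    node≉1 : ∀ i b → node (i , b) ≉ 1#
    node≉1 i b eq = x^t≉1 b (trans (sym (node-^t i b)) (trans (^-congˡ t eq) (1^n≈1 t)))

    points-distinct : AllPairs _≉_ points
    points-distinct = subst (AllPairs _≉_) (≡.sym points≡) (AllPairs.++⁺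
      (AllPairs.map⁺ (Unique⇒AllPairs indices-unique λ k∈ l∈ k≢l → k≢l ∘ node-injective (bound k∈) (bound l∈)))
      ([] ∷ []) (All.map⁺ (All.tabulate {xs = indices} λ { {i , b} _ → node≉1 i b ∷ [] })))
      where
      bound : ∀ {i b} → (i , b) ∈ indices → i < t
      bound k∈ = ∈-upTo⁻ (proj₁ (∈-cartesianProduct⁻ (upTo t) (allFin n) k∈))

    Xᵗ-distinct : AllPairs _≉_ Xᵗ
    Xᵗ-distinct = AllPairs.map⁺ (AllPairs.map (λ i≢j eq → i≢j (x^t-injective _ _ eq)) (Unique.allFin⁺ n))

    Xᵗ,1-distinct : AllPairs _≉_ Xᵗ,1
    Xᵗ,1-distinct = AllPairs.++⁺ Xᵗ-distinct ([] ∷ [])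
      (All.map⁺ (All.tabulate {xs = allFin n} λ {b} _ → x^t≉1 b ∷ []))

    schurProduct : ℕ → List ℕ → Carrier
    schurProduct c lam = schur Xᵗ,1 (quotient t c lam) · ∏ (λ i → schur Xᵗ (quotient t i lam)) (others c)

    alternantProduct≈schurProduct : ∀ {c} lam → c < t →
      alternantProduct c lam ≈ schurProduct c lam · emptyProduct
    alternantProduct≈schurProduct {c} lam c<t = begin
      alternantProduct c lam
        ≈⟨ *-cong (schur-· (quotient t c lam) Xᵗ,1-distinct)
             (∏-cong (All.tabulate {xs = L} λ {i} _ → schur-· (quotient t i lam) Xᵗ-distinct)) ⟩
      (S · v₁) · ∏ (λ i → schur Xᵗ (quotient t i lam) · v) L
        ≈⟨ *-congˡ (trans (∏-· L) (*-congˡ (∏-const v L))) ⟩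
      (S · v₁) · (∏ (λ i → schur Xᵗ (quotient t i lam)) L · v ^ length L)
        ≡⟨ cong (λ k → (S · v₁) · (∏ (λ i → schur Xᵗ (quotient t i lam)) L · v ^ k)) (length-others c<t) ⟩
      (S · v₁) · (∏ (λ i → schur Xᵗ (quotient t i lam)) L · v ^ (t ∸ 1))
        ≈⟨ solve 4 (λ s v p w → (s :* v) :* (p :* w) := (s :* p) :* (v :* w)) refl _ _ _ _ ⟩
      schurProduct c lam · emptyProduct ∎
      where
      L = others c
      S = schur Xᵗ,1 (quotient t c lam)
      v = alternant Xᵗ []
      v₁ = alternant Xᵗ,1 []

    alternant-ratio : ∀ {c} lam → c < t → length lam ≡ t * n + 1 → Decreasing lam →
      RowCoreSizes c n (beta lam) →
      alternant points lam ≈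
        ((sign (triangle t * triangle (suc n) + c * n) · sign (inversions (sigmaList t c lam)))
          · schurProduct c lam) · alternant points []
    alternant-ratio {c} lam c<t len dec sizes = begin
      alternant points lam
        ≈⟨ alternant-points-row-core lam c<t len dec sizes ⟩
      s · (DFT · (sign (c * (n * n) + w) · (M · alternantProduct c lam)))
        ≈⟨ *-congˡ (*-congˡ (*-cong (sign-combine τ c n w) (*-congˡ (alternantProduct≈schurProduct lam c<t)))) ⟩
      s · (DFT · ((sign τ · (sign (τ + c * n) · sign w)) · (M · (S · emptyProduct))))
        ≈⟨ solve 8 (λ s d e f r m p q → s :* (d :* ((e :* (f :* r)) :* (m :* (p :* q))))
             := ((f :* s) :* p) :* (e :* (d :* (r :* (m :* q)))))
             refl s DFT (sign τ) (sign (τ + c * n)) (sign w) M S emptyProduct ⟩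
      ((sign (τ + c * n) · s) · S) · (sign τ · (DFT · (sign w · (M · emptyProduct))))
        ≈⟨ *-congˡ alternant-points-∅ ⟨
      ((sign (τ + c * n) · s) · S) · alternant points [] ∎
      where
      s = sign (inversions (sigmaList t c lam))
      τ = triangle t * triangle (suc n)
      w = (t ∸ 1) * n
      M = ∏ monomial (upTo t)
      S = schurProduct c lam

    schur-long-core : ∀ {lam κ} → length lam ≡ t * n + 1 → Decreasing lam → IsCore t lam κ → 1 < partLength κ →
      schur points lam ≈ 0#
    schur-long-core {lam} len dec isCore long with L , uL , crowded ← long-core-crowded dec isCore len long =
      schur-unique lam points-distinct (begin
      alternant points lam               ≈⟨ alternant-points lam len ⟩
      vandermonde points (beta lam)      ≈⟨ vandermonde-points (beta lam) ⟩
      DFT · det residueRows (beta lam)   ≈⟨ *-congˡ (det-residueRows-vanishes (beta lam) uL crowded) ⟩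
      DFT · 0#                           ≈⟨ trans (zeroʳ DFT) (sym (zeroˡ _)) ⟩
      0# · alternant points []           ∎)

    schur-row-core : ∀ {c lam} → c < t → length lam ≡ t * n + 1 → Decreasing lam →
      IsCore t lam (c ∷ replicate (t * n) 0) →
      schur points lam ≈
        (sgnPow (((t * (t ∸ 1)) / 2) * ((n * suc n) / 2) + c * n) · sgn (sigmaList t c lam))
          · (schur Xᵗ,1 (quotient t c lam)
             · prod (map (λ i → schur Xᵗ (quotient t i lam)) (keep (λ i → not (i ≡ᵇ c)) (upTo t))))
    schur-row-core {c} {lam} c<t len dec (reach , _) = begin
      schur points lam
        ≈⟨ schur-unique lam points-distinct (alternant-ratio lam c<t len dec (row-core-sizes c<t reach)) ⟩
      (sign (triangle t * triangle (suc n) + c * n) · sign (inversions σ)) · schurProduct c lam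
        ≡⟨ cong (λ k → (sign (k + c * n) · sign (inversions σ)) · schurProduct c lam) triangles≡ ⟩
      (sign (τ + c * n) · sign (inversions σ)) · schurProduct c lam
        ≡⟨ cong₂ (λ u v → (u · v) · schurProduct c lam) (sgnPow≡sign (τ + c * n)) (sgnPow≡sign (inversions σ)) ⟨
      (sgnPow (τ + c * n) · sgn σ) · schurProduct c lam
        ≡⟨ cong (λ L → (sgnPow (τ + c * n) · sgn σ) · (S · P L)) (keep≡others c) ⟨
      (sgnPow (τ + c * n) · sgn σ) · (S · P (keep (λ i → not (i ≡ᵇ c)) (upTo t))) ∎
      where
      σ = sigmaList t c lam
      S = schur Xᵗ,1 (quotient t c lam)
      P = ∏ (λ i → schur Xᵗ (quotient t i lam))
      τ = ((t * (t ∸ 1)) / 2) * ((n * suc n) / 2)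
      triangles≡ : triangle t * triangle (suc n) ≡ τ
      triangles≡ = cong₂ _*_ (triangle≡ t) (≡.trans (triangle≡ (suc n)) (cong (_/ 2) (ℕ.*-comm (suc n) n)))

theorem2p7 : ∀ {a ℓ} (F : Field a ℓ) →
    let open FieldOps F in
    (t n : ℕ) → .{{_ : NonZero t}} → 2 ≤ t → 1 ≤ n →
    (ω : Carrier) → Primitive t ω →
    (x : Fin n → Carrier) →
    (∀ i → ¬ (x i ≈ 0#)) →
    (∀ i j → x i ^ t ≈ x j ^ t → i ≡ j) →
    (∀ i → ¬ (x i ^ t ≈ 1#)) →
    (lam : List ℕ) → Data.List.length lam ≡ t * n + 1 → Decreasing lam →
    -- (1)
    ((∃ λ κ → IsCore t lam κ × 1 < partLength κ) →
       schur (spec t n ω x) lam ≈ 0#)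
    ×
    -- (2)
    (∀ c → c < t → IsCore t lam (c ∷ replicate (t * n) 0) →
       schur (spec t n ω x) lam ≈
         ((sgnPow (((t * (t ∸ 1)) / 2) * ((n * suc n) / 2) + c * n)
            · sgn (sigmaList t c lam))
          · (schur (powVars t n x ++ (1# ∷ [])) (quotient t c lam)
             · prod (map (λ i → schur (powVars t n x) (quotient t i lam))
                         (keep (λ i → not (i ≡ᵇ c)) (upTo t))))))
theorem2p7 F t n _ _ ω ω-primitive x x≉0 x^t-injective x^t≉1 lam len dec =
  (λ (κ , isCore , long) → schur-long-core x≉0 x^t-injective x^t≉1 len dec isCore long) ,
  (λ c c<t → schur-row-core x≉0 x^t-injective x^t≉1 c<t len dec)
  where open Specialisation F t n ω ω-primitive x
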